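{- Let $P$ be the transition matrix of a reversible and ergodic Markov chain on $V$ with stationary distribution $\pi$ and mixing rate $t^*$. For the billiard router model for $P$, with any initial configuration, $$\left|\chi^{(T)}_w-\mu^{(T)}_w\right|\le\frac{3\pi_w}{\pi_{\min}}\,t^*\,\Delta(\Delta-1)$$ for all $w\in V$ and $T\ge0$.
   Context: Let $V=\{1,\dots,N\}$ and let $P\in\mathbb{R}_{\ge 0}^{N\times N}$ be an ergodic (irreducible, aperiodic) stochastic matrix with stationary distribution $\pi$; $\pi_{\min}=\min_v\pi_v$; reversible means $\pi_uP_{u,v}=\pi_vP_{v,u}$ for all $u,v$. For $v\in V$ let $\mathcal N(v)=\{u: P_{v,u}>0\}$, $\delta(v)=|\mathcal N(v)|$, $\Delta=\max_v\delta(v)$. Total variation distance $d_{TV}(\xi,\zeta)=\frac12\|\xi-\zeta\|_1$; mixing time $\tau(\varepsilon)=\max_{v}\min\{t\ge0: d_{TV}(P^t_{v,\cdot},\pi)\le\varepsilon\}$; mixing rate $t^*=\tau(1/4)$. A functional-router model consists of functions $\sigma_v:\mathbb{Z}_{\ge0}\to\mathcal N(v)$; write $I_{v,u}[z,z')=|\{j\in\{z,\dots,z'-1\}:\sigma_v(j)=u\}|$ (zero if $z'\le z$). Given $\chi^{(0)}\in\mathbb{Z}_{\ge0}^N$, set $Z^{(t)}_{v,u}=I_{v,u}\big[\sum_{s=0}^{t-1}\chi^{(s)}_v,\sum_{s=0}^{t}\chi^{(s)}_v\big)$, $\chi^{(t+1)}_u=\sum_vZ^{(t)}_{v,u}$,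 $\mu^{(0)}=\chi^{(0)}$, $\mu^{(t)}=\mu^{(0)}P^t$. The billiard router is defined recursively: $\sigma_v(i)$ is an element $u\in\mathcal N(v)$ minimizing $(I_{v,u}[0,i)+1)/P_{v,u}$ (ties broken arbitrarily). It is known (billiard sequences) that for this router $|I_{v,u}[z,z')-(z'-z)P_{v,u}|\le 1+(\delta(v)-2)P_{v,u}$ for all $v,u$ and $z'>z\ge0$. -}

module Defs where

open import Algebra.Bundles using (CommutativeRing)
open import Data.Bool.Base using (if_then_else_)
open import Data.Fin.Base using (Fin)
import Data.Fin.Properties as Fin
open import Data.List.Base using (length; filter; allFin; applyUpTo; tabulate)
import Data.List.Extrema as Extrema
open import Data.Nat.Base as ℕ using (ℕ; zero; suc; _∸_)
import Data.Nat.Properties as ℕ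
open import Data.Nat.Divisibility using (_∣_)
open import Data.Product.Base using (Σ-syntax; ∃-syntax; _×_)
open import Level using (Level; _⊔_) renaming (suc to lsuc)
open import Relation.Binary.Bundles using (DecTotalOrder; TotalOrder)
open import Relation.Binary.Core using (Rel)
import Relation.Binary.Construct.NonStrictToStrict as NonStrictToStrict
open import Relation.Binary.Definitions using (Decidable)
open import Relation.Binary.PropositionalEquality.Core using (_≡_)
open import Relation.Binary.Structures using (IsDecTotalOrder)
open import Relation.Nullary.Decidable.Core using (does)
open import Relation.Nullary.Negation.Core using (¬_)
open import Relation.Unary using (Pred)

-- The real numbers, given by their classical axiomatisation as a
-- Dedekind-complete totally ordered field, which determines them up to
-- isomorphism.  Decidability of the order, a theorem of classical
-- mathematics for ℝ, is part of the axioms.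
record Reals (c ℓ₁ ℓ₂ : Level) : Set (lsuc (c ⊔ ℓ₁ ⊔ ℓ₂)) where
  infix  4 _≤_
  infix  8 _⁻¹
  field
    commutativeRing : CommutativeRing c ℓ₁
  open CommutativeRing commutativeRing public
    using (Carrier; _≈_; _+_; _*_; -_; _-_; 0#; 1#; semiring)
  field
    _≤_             : Rel Carrier ℓ₂
    isDecTotalOrder : IsDecTotalOrder _≈_ _≤_
    0≉1             : ¬ 0# ≈ 1#
    +-monoˡ-≤       : ∀ {x y} z → x ≤ y → x + z ≤ y + z
    *-nonNeg        : ∀ {x y} → 0# ≤ x → 0# ≤ y → 0# ≤ x * y
    -- Total for convenience; the value at 0# is unspecified.
    _⁻¹             : Carrier → Carrier
    *-inverseʳ      : ∀ {x} → ¬ x ≈ 0# → x * x ⁻¹ ≈ 1#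

  IsUpperBound : Pred Carrier (c ⊔ ℓ₁ ⊔ ℓ₂) → Carrier → Set (c ⊔ ℓ₁ ⊔ ℓ₂)
  IsUpperBound S b = ∀ {x} → S x → x ≤ b

  field
    complete : (S : Pred Carrier (c ⊔ ℓ₁ ⊔ ℓ₂)) →
               ∃[ x ] S x → ∃[ b ] IsUpperBound S b →
               ∃[ s ] (IsUpperBound S s × (∀ b → IsUpperBound S b → s ≤ b))

  decTotalOrder : DecTotalOrder c ℓ₁ ℓ₂
  decTotalOrder = record { isDecTotalOrder = isDecTotalOrder }

  totalOrder : TotalOrder c ℓ₁ ℓ₂
  totalOrder = DecTotalOrder.totalOrder decTotalOrder

  open NonStrictToStrict _≈_ _≤_ public using (_<_)

  _<?_ : Decidable _<_
  _<?_ = NonStrictToStrict.<-decidable _≈_ _≤_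
           (DecTotalOrder._≟_ decTotalOrder) (DecTotalOrder._≤?_ decTotalOrder)

  open import Algebra.Construct.NaturalChoice.Max totalOrder public
    using () renaming (_⊔_ to _⊔ᵣ_)

  open import Algebra.Properties.Semiring.Sum semiring public
    using (sum-syntax)

  open import Algebra.Definitions.RawMonoid
    (CommutativeRing.+-rawMonoid commutativeRing)
    using () renaming (_×_ to _·_)

  infixl 7 _/_

  _/_ : Carrier → Carrier → Carrier
  x / y = x * y ⁻¹

  ∣_∣ᵣ : Carrier → Carrier
  ∣ x ∣ᵣ = x ⊔ᵣ (- x)

  fromℕ : ℕ → Carrier
  fromℕ n = n · 1#

module Routing {c ℓ₁ ℓ₂ : Level} (ℛ : Reals c ℓ₁ ℓ₂) where

  open Reals ℛ
  open import Algebra.Properties.Semiring.Sum ℕ.+-*-semiring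
    using () renaming (sum to sumℕ)

  Matrix : ℕ → Set c
  Matrix N = Fin N → Fin N → Carrier

  maxℕ : ∀ {N} → (Fin N → ℕ) → ℕ
  maxℕ f = Extrema.max ℕ.≤-totalOrder 0 (tabulate f)

  module _ {N : ℕ} where

    infixr 8 _^_

    _^_ : Matrix N → ℕ → Matrix N
    (P ^ zero)  u w = if does (u Fin.≟ w) then 1# else 0#
    (P ^ suc t) u w = ∑[ v < N ] ((P ^ t) u v * P v w)

    IsStochastic : Matrix N → Set (ℓ₁ ⊔ ℓ₂)
    IsStochastic P = (∀ u v → 0# ≤ P u v) × (∀ u → ∑[ v < N ] P u v ≈ 1#)

    IsIrreducible : Matrix N → Set (ℓ₁ ⊔ ℓ₂)
    IsIrreducible P = ∀ u v → ∃[ t ] 0# < (P ^ t) u v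

    -- gcd { t > 0 : (P ^ t) v v > 0 } = 1 for every v: the only common
    -- divisor of the return times is 1.
    IsAperiodic : Matrix N → Set (ℓ₁ ⊔ ℓ₂)
    IsAperiodic P =
      ∀ v d → (∀ t → 0 ℕ.< t → 0# < (P ^ t) v v → d ∣ t) → d ≡ 1

    IsErgodic : Matrix N → Set (ℓ₁ ⊔ ℓ₂)
    IsErgodic P = IsIrreducible P × IsAperiodic P

    IsStationary : Matrix N → (Fin N → Carrier) → Set (ℓ₁ ⊔ ℓ₂)
    IsStationary P π =
      (∀ v → 0# ≤ π v) ×
      ∑[ v < N ] π v ≈ 1# ×
      (∀ w → ∑[ v < N ] (π v * P v w) ≈ π w)

    IsReversible : Matrix N → (Fin N → Carrier) → Set ℓ₁
    IsReversible P π = ∀ u v → π u * P u v ≈ π v * P v u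

    -- The base value 1# is harmless: probabilities are at most 1#, so this is
    -- the minimum of π over the states.
    πmin : (Fin N → Carrier) → Carrier
    πmin π = Extrema.min totalOrder 1# (tabulate π)

    dTV : (Fin N → Carrier) → (Fin N → Carrier) → Carrier
    dTV ξ ζ = (1# / fromℕ 2) * (∑[ v < N ] ∣ ξ v - ζ v ∣ᵣ)

    IsLeast : ∀ {ℓ} → (ℕ → Set ℓ) → ℕ → Set ℓ
    IsLeast Q m = Q m × (∀ t → Q t → m ℕ.≤ t)

    -- τ(ε) = max_v min { t : dTV(P ^ t v , π) ≤ ε }, with  hit v  the inner
    -- minimum.
    IsMixingTime : Matrix N → (Fin N → Carrier) → Carrier → ℕ → Set ℓ₂
    IsMixingTime P π ε τ =
      Σ[ hit ∈ (Fin N → ℕ) ]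
        (∀ v → IsLeast (λ t → dTV ((P ^ t) v) π ≤ ε) (hit v)) ×
        τ ≡ maxℕ hit

    IsMixingRate : Matrix N → (Fin N → Carrier) → ℕ → Set ℓ₂
    IsMixingRate P π = IsMixingTime P π (1# / fromℕ 4)

    _∈𝒩[_]_ : Fin N → Matrix N → Fin N → Set (ℓ₁ ⊔ ℓ₂)
    u ∈𝒩[ P ] v = 0# < P v u

    δ : Matrix N → Fin N → ℕ
    δ P v = length (filter (λ u → 0# <? P v u) (allFin N))

    Δ : Matrix N → ℕ
    Δ P = maxℕ (δ P)

    record Router (P : Matrix N) : Set (ℓ₁ ⊔ ℓ₂) where
      field
        σ   : Fin N → ℕ → Fin N
        σ∈𝒩 : ∀ v i → σ v i ∈𝒩[ P ] v

    module _ {P : Matrix N} (ρ : Router P) where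
      open Router ρ

      -- The list is z , z + 1 , … , z′ - 1, and is empty when z′ ≤ z.
      I : Fin N → Fin N → ℕ → ℕ → ℕ
      I v u z z′ =
        length (filter (λ j → σ v j Fin.≟ u) (applyUpTo (z ℕ.+_) (z′ ∸ z)))

      -- Any choice among the minimisers is allowed.
      IsBilliard : Set (ℓ₁ ⊔ ℓ₂)
      IsBilliard = ∀ v i u → u ∈𝒩[ P ] v →
        fromℕ (I v (σ v i) 0 i ℕ.+ 1) / P v (σ v i)
          ≤ fromℕ (I v u 0 i ℕ.+ 1) / P v u

      module _ (χ₀ : Fin N → ℕ) where

        mutual
          χ : ℕ → Fin N → ℕ
          χ zero    u = χ₀ u
          χ (suc t) u = sumℕ (λ v → Z t v u)

          Z : ℕ → Fin N → Fin N → ℕ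
          Z t v u = I v u (served t v) (served t v ℕ.+ χ t v)

          -- served t v is the sum of χ s v over s < t.
          served : ℕ → Fin N → ℕ
          served zero    v = 0
          served (suc t) v = served t v ℕ.+ χ t v

    μ : Matrix N → (Fin N → ℕ) → ℕ → Fin N → Carrier
    μ P χ₀ t w = ∑[ v < N ] (fromℕ (χ₀ v) * (P ^ t) v w)

module Submission where

-- One step of the router model differs from one step of the chain by the
-- errors Z v u - χ v * P v u, which sum to 0 over u.  Hence χ T w - μ T w is a
-- sum over s < T of errors weighted by (P ^ s) u w - π w instead of
-- (P ^ s) u w.  Reversibility turns this weight into π w / π u times
-- (P ^ s) w u - π u, whose ℓ¹ norm over u is at most 2 for s < t*, at most ½
-- from t* on, and halves every t* steps: the sum over s is at most 3 t*.  Each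
-- error is at most Δ - 1 by the discrepancy bound for billiard sequences, and
-- u is a neighbour of at most Δ states.

-- Without the shift by `π w` the weights would tend to `π w`, and a bound on their sum would grow
-- with `T`. In the index u the shifted weights form a column, whereas mixing speaks only about
-- rows; transposing them by detailed balance is what costs the factor `π w / πmin π`. The halving
-- rests on the deviations from `π` multiplying like matrices, which holds because each of their
-- rows has total mass zero. The constant 3 is 2 + 1: the first t* terms are at most 2 each, and the
-- remaining sum is at most t*, by comparison with half of itself. In the billiard bound all
-- neighbours of a state follow one common clock whose speed is unknown; the counts adding up to the
-- number of calls eliminates that speed.

open import Defs
open import Algebra.Bundles using (CommutativeRing)
open import Algebra.Bundles.Raw using (RawRing)
open import Data.Bool.Base using (Bool; true; false; if_then_else_)
open import Data.Fin.Base using (Fin; zero; suc)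
import Data.Fin.Properties as Fin
open import Data.Integer.Base as ℤ using (ℤ; +_; -[1+_])
import Data.Integer.Properties as ℤ
open import Data.List.Base using (List; []; _∷_; [_]; length; filter; tabulate; applyUpTo)
import Data.List.Extrema as Extrema
open import Data.List.Properties using (length-applyUpTo)
import Data.List.Relation.Unary.All.Properties as All
open import Data.Maybe.Base as Maybe using (Maybe)
open import Data.Nat.Base as ℕ using (ℕ; zero; suc)
import Data.Nat.Properties as ℕ
open import Data.Product.Base using (_×_; _,_; proj₁; proj₂)
import Data.Sign.Base as Sign
open import Data.Sum.Base using (_⊎_; inj₁; inj₂)
open import Function.Base using (_∘_; id)
open import Relation.Binary.Bundles using (DecTotalOrder)
open import Relation.Binary.PropositionalEquality.Core as ≡ using (_≡_)
import Relation.Binary.Reasoning.PartialOrder as PosetReasoning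
import Relation.Binary.Reasoning.Setoid as SetoidReasoning
open import Relation.Nullary.Decidable.Core using (Dec; does; yes; no; dec⇒maybe)
open import Relation.Nullary.Negation.Core using (¬_; contradiction)
open import Relation.Unary using (Pred; Decidable)

-- The library's ring solver needs coefficients with computable equality,
-- which an abstract ring does not have, so ℤ is mapped into the ring.
module IntegerCoefficients {c ℓ} (R : CommutativeRing c ℓ) where

  open CommutativeRing R
  open import Algebra.Properties.Ring ring
  open import Algebra.Properties.Semiring.Mult.TCOptimised semiring
    renaming (_×_ to _·_)
  open import Algebra.Solver.Ring.AlmostCommutativeRing
    using (_-Raw-AlmostCommutative⟶_; fromCommutativeRing)
  open SetoidReasoning setoid

  -- With the optimised multiple, `1 · 1#` computes to `1#` with no trailing `0#`, so `con (+ 1)` in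
  -- solver terms denotes `1#` itself.
  fromℤ : ℤ → Carrier
  fromℤ (+ n)    = n · 1#
  fromℤ -[1+ n ] = - (suc n · 1#)

  fromℤ-⊖ : ∀ m n → fromℤ (m ℤ.⊖ n) ≈ m · 1# - n · 1#
  fromℤ-⊖ m       zero    = sym (trans (+-congˡ -0#≈0#) (+-identityʳ _))
  fromℤ-⊖ zero    (suc n) = sym (+-identityˡ _)
  fromℤ-⊖ (suc m) (suc n) = begin
    fromℤ (suc m ℤ.⊖ suc n)
      ≡⟨ ≡.cong fromℤ (ℤ.[1+m]⊖[1+n]≡m⊖n m n) ⟩
    fromℤ (m ℤ.⊖ n)
      ≈⟨ fromℤ-⊖ m n ⟩
    a - b
      ≈⟨ +-congʳ (xyx⁻¹≈y 1# a) ⟨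
    1# + a - 1# - b
      ≈⟨ +-assoc _ _ _ ⟩
    1# + a + (- 1# - b)
      ≈⟨ +-congˡ (-‿+-comm 1# b) ⟩
    1# + a - (1# + b)
      ≈⟨ +-cong (1+× m 1#) (-‿cong (1+× n 1#)) ⟨
    suc m · 1# - suc n · 1#
      ∎
    where
    a = m · 1#
    b = n · 1#

  fromℤ-+ : ∀ i j → fromℤ (i ℤ.+ j) ≈ fromℤ i + fromℤ j
  fromℤ-+ (+ m)    (+ n)    = ×-homo-+ 1# m n
  fromℤ-+ (+ m)    -[1+ n ] = fromℤ-⊖ m (suc n)
  fromℤ-+ -[1+ m ] (+ n)    = trans (fromℤ-⊖ n (suc m)) (+-comm _ _)
  fromℤ-+ -[1+ m ] -[1+ n ] = begin
    - (suc (suc m ℕ.+ n) · 1#)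
      ≡⟨ ≡.cong (λ k → - (k · 1#)) (ℕ.+-suc (suc m) n) ⟨
    - ((suc m ℕ.+ suc n) · 1#)
      ≈⟨ -‿cong (×-homo-+ 1# (suc m) (suc n)) ⟩
    - (suc m · 1# + suc n · 1#)
      ≈⟨ sym (-‿+-comm _ _) ⟩
    - (suc m · 1#) - suc n · 1#
      ∎

  fromℤ-+◃ : ∀ n → fromℤ (Sign.+ ℤ.◃ n) ≈ n · 1#
  fromℤ-+◃ zero    = refl
  fromℤ-+◃ (suc n) = refl

  fromℤ--◃ : ∀ n → fromℤ (Sign.- ℤ.◃ n) ≈ - (n · 1#)
  fromℤ--◃ zero    = sym -0#≈0#
  fromℤ--◃ (suc n) = refl

  fromℤ-* : ∀ i j → fromℤ (i ℤ.* j) ≈ fromℤ i * fromℤ j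
  fromℤ-* (+ m) (+ n) = trans (fromℤ-+◃ (m ℕ.* n)) (×1-homo-* m n)
  fromℤ-* (+ m) -[1+ n ] = trans (fromℤ--◃ (m ℕ.* suc n))
    (trans (-‿cong (×1-homo-* m (suc n))) (-‿distribʳ-* _ _))
  fromℤ-* -[1+ m ] (+ n) = trans (fromℤ--◃ (suc m ℕ.* n))
    (trans (-‿cong (×1-homo-* (suc m) n)) (-‿distribˡ-* _ _))
  fromℤ-* -[1+ m ] -[1+ n ] = trans (fromℤ-+◃ (suc m ℕ.* suc n))
    (trans (×1-homo-* (suc m) (suc n)) (trans (sym (-‿involutive _))
      (trans (-‿cong (-‿distribˡ-* _ _)) (-‿distribʳ-* _ _))))

  fromℤ-neg : ∀ i → fromℤ (ℤ.- i) ≈ - fromℤ i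
  fromℤ-neg (+ zero)  = sym -0#≈0#
  fromℤ-neg (+ suc n) = refl
  fromℤ-neg -[1+ n ]  = sym (-‿involutive _)

  ℤ-rawRing : RawRing _ _
  ℤ-rawRing = CommutativeRing.rawRing ℤ.+-*-commutativeRing

  fromℤ-homomorphism : ℤ-rawRing -Raw-AlmostCommutative⟶ fromCommutativeRing R
  fromℤ-homomorphism = record
    { ⟦_⟧ = fromℤ ; +-homo = fromℤ-+ ; *-homo = fromℤ-* ; -‿homo = fromℤ-neg
    ; 0-homo = refl ; 1-homo = refl }

  fromℤ-≟ : ∀ i j → Maybe (fromℤ i ≈ fromℤ j)
  fromℤ-≟ i j = Maybe.map (λ i≡j → reflexive (≡.cong fromℤ i≡j)) (dec⇒maybe (i ℤ.≟ j))

  open import Algebra.Solver.Ring ℤ-rawRing (fromCommutativeRing R)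
    fromℤ-homomorphism fromℤ-≟ public
    using (solve; _:=_; _:+_; _:*_; _:-_; :-_; con)

-- Ordered-field arithmetic, absolute values, finite sums, counting

module OrderedField {c ℓ₁ ℓ₂} (ℛ : Reals c ℓ₁ ℓ₂) where

  open Reals ℛ
  open CommutativeRing commutativeRing public
    hiding (Carrier; _≈_; _+_; _*_; -_; _-_; 0#; 1#; semiring; zero)
    renaming (refl to ≈-refl; sym to ≈-sym; trans to ≈-trans; reflexive to ≈-reflexive)
  open DecTotalOrder decTotalOrder public
    using (_≟_; antisym; total; ≤-respˡ-≈; ≤-respʳ-≈)
    renaming (refl to ≤-refl; trans to ≤-trans; reflexive to ≤-reflexive)
  open IntegerCoefficients commutativeRing public
    using (solve; _:=_; _:+_; _:*_; _:-_; :-_; con)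
  open import Algebra.Properties.Semiring.Sum semiring public
    hiding (sum-syntax)
  open import Algebra.Properties.Semiring.Mult semiring public
    using (×-homo-+)
  open import Algebra.Properties.Ring ring public
    using (-‿involutive; -0#≈0#; -‿distribˡ-*; -‿distribʳ-*)
  open import Algebra.Construct.NaturalChoice.Max totalOrder public
    using (⊔-lub; x≤x⊔y; x≤y⊔x; ⊔-cong; ⊔-comm)
  module ≤-Reasoning = PosetReasoning (DecTotalOrder.poset decTotalOrder)
  module ≈-Reasoning = SetoidReasoning setoid

  -- Reduces an inequality to a nonnegative witness and a ring identity, which the solver can check.
  ≤-via-gap : ∀ {x y} d → 0# ≤ d → y ≈ x + d → x ≤ y
  ≤-via-gap {x} {y} d 0≤d y≈x+d =
    ≤-respˡ-≈ (+-identityˡ x) (≤-respʳ-≈ (≈-trans (+-comm d x) (≈-sym y≈x+d)) (+-monoˡ-≤ x 0≤d))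

  0≤y-x : ∀ {x y} → x ≤ y → 0# ≤ y - x
  0≤y-x {x} x≤y = ≤-respˡ-≈ (-‿inverseʳ x) (+-monoˡ-≤ (- x) x≤y)

  +-mono-≤ : ∀ {x y u v} → x ≤ y → u ≤ v → x + u ≤ y + v
  +-mono-≤ {x} {y} {u} {v} x≤y u≤v = ≤-trans (+-monoˡ-≤ u x≤y)
    (≤-respˡ-≈ (+-comm u y) (≤-respʳ-≈ (+-comm v y) (+-monoˡ-≤ y u≤v)))

  +-monoʳ-≤ : ∀ x {u v} → u ≤ v → x + u ≤ x + v
  +-monoʳ-≤ x u≤v = +-mono-≤ ≤-refl u≤v

  +-nonNeg : ∀ {x y} → 0# ≤ x → 0# ≤ y → 0# ≤ x + y
  +-nonNeg 0≤x 0≤y = ≤-respˡ-≈ (+-identityˡ 0#) (+-mono-≤ 0≤x 0≤y)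

  neg-antimono-≤ : ∀ {x y} → x ≤ y → - y ≤ - x
  neg-antimono-≤ {x} {y} x≤y = ≤-via-gap (y - x) (0≤y-x x≤y)
    (solve 2 (λ x y → :- x := :- y :+ (y :- x)) ≈-refl x y)

  neg-nonNeg : ∀ {x} → x ≤ 0# → 0# ≤ - x
  neg-nonNeg x≤0 = ≤-respˡ-≈ -0#≈0# (neg-antimono-≤ x≤0)

  *-monoˡ-≤ : ∀ {x y z} → 0# ≤ z → x ≤ y → z * x ≤ z * y
  *-monoˡ-≤ {x} {y} {z} 0≤z x≤y = ≤-via-gap (z * (y - x)) (*-nonNeg 0≤z (0≤y-x x≤y))
    (solve 3 (λ x y z → z :* y := z :* x :+ z :* (y :- x)) ≈-refl x y z)

  *-monoʳ-≤ : ∀ {x y z} → 0# ≤ z → x ≤ y → x * z ≤ y * z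
  *-monoʳ-≤ 0≤z x≤y = ≤-respˡ-≈ (*-comm _ _) (≤-respʳ-≈ (*-comm _ _) (*-monoˡ-≤ 0≤z x≤y))

  0≤1 : 0# ≤ 1#
  0≤1 with total 0# 1#
  ... | inj₁ 0≤1 = 0≤1
  ... | inj₂ 1≤0 = ≤-respʳ-≈ (solve 0 (:- con (+ 1) :* :- con (+ 1) := con (+ 1)) ≈-refl)
                     (*-nonNeg (neg-nonNeg 1≤0) (neg-nonNeg 1≤0))

  1≰0 : ¬ 1# ≤ 0#
  1≰0 1≤0 = 0≉1 (antisym 0≤1 1≤0)

  pos⇒nonZero : ∀ {x} → 0# < x → ¬ x ≈ 0#
  pos⇒nonZero (_ , 0≉x) x≈0 = 0≉x (≈-sym x≈0)

  pos : ∀ {x} → 0# ≤ x → ¬ x ≈ 0# → 0# < x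
  pos 0≤x x≉0 = 0≤x , λ 0≈x → x≉0 (≈-sym 0≈x)

  pos⇒⁻¹-nonNeg : ∀ {x} → 0# < x → 0# ≤ x ⁻¹
  pos⇒⁻¹-nonNeg {x} 0<x with total 0# (x ⁻¹)
  ... | inj₁ 0≤x⁻¹ = 0≤x⁻¹
  ... | inj₂ x⁻¹≤0 = contradiction
    (≤-respˡ-≈ (*-inverseʳ (pos⇒nonZero 0<x))
      (≤-respʳ-≈ (zeroʳ x) (*-monoˡ-≤ (proj₁ 0<x) x⁻¹≤0)))
    1≰0

  nonNeg-sum-zero : ∀ {x y} → 0# ≤ x → 0# ≤ y → x + y ≈ 0# → x ≈ 0#
  nonNeg-sum-zero {x} {y} 0≤x 0≤y x+y≈0 = antisym
    (≤-via-gap y 0≤y (≈-sym x+y≈0)) 0≤x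

  *-cancel-zero : ∀ {x y} → ¬ y ≈ 0# → x * y ≈ 0# → x ≈ 0#
  *-cancel-zero {x} {y} y≉0 xy≈0 = begin
    x               ≈⟨ *-identityʳ x ⟨
    x * 1#          ≈⟨ *-congˡ (*-inverseʳ y≉0) ⟨
    x * (y * y ⁻¹)  ≈⟨ *-assoc x y (y ⁻¹) ⟨
    x * y * y ⁻¹    ≈⟨ *-congʳ xy≈0 ⟩
    0# * y ⁻¹       ≈⟨ zeroˡ _ ⟩
    0#              ∎
    where open ≈-Reasoning

  /-*-cancel : ∀ {x y} → 0# < y → x / y * y ≈ x
  /-*-cancel {x} {y} 0<y = begin
    x * y ⁻¹ * y    ≈⟨ *-assoc x _ _ ⟩
    x * (y ⁻¹ * y)  ≈⟨ *-congˡ (≈-trans (*-comm _ _) (*-inverseʳ (pos⇒nonZero 0<y))) ⟩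
    x * 1#          ≈⟨ *-identityʳ x ⟩
    x               ∎
    where open ≈-Reasoning

  -- Absolute value

  ∣∣-cong : ∀ {x y} → x ≈ y → ∣ x ∣ᵣ ≈ ∣ y ∣ᵣ
  ∣∣-cong x≈y = ⊔-cong x≈y (-‿cong x≈y)

  x≤∣x∣ : ∀ x → x ≤ ∣ x ∣ᵣ
  x≤∣x∣ x = x≤x⊔y x (- x)

  -x≤∣x∣ : ∀ x → - x ≤ ∣ x ∣ᵣ
  -x≤∣x∣ x = x≤y⊔x x (- x)

  ∣x∣≈x : ∀ {x} → 0# ≤ x → ∣ x ∣ᵣ ≈ x
  ∣x∣≈x {x} 0≤x = antisym
    (⊔-lub ≤-refl (≤-trans (≤-respʳ-≈ -0#≈0# (neg-antimono-≤ 0≤x)) 0≤x))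
    (x≤∣x∣ x)

  ∣-x∣≈∣x∣ : ∀ x → ∣ - x ∣ᵣ ≈ ∣ x ∣ᵣ
  ∣-x∣≈∣x∣ x = ≈-trans (⊔-cong ≈-refl (-‿involutive x)) (⊔-comm (- x) x)

  ∣∣-nonNeg : ∀ x → 0# ≤ ∣ x ∣ᵣ
  ∣∣-nonNeg x with total 0# x
  ... | inj₁ 0≤x = ≤-trans 0≤x (x≤∣x∣ x)
  ... | inj₂ x≤0 = ≤-trans (neg-nonNeg x≤0) (-x≤∣x∣ x)

  ∣x+y∣≤∣x∣+∣y∣ : ∀ x y → ∣ x + y ∣ᵣ ≤ ∣ x ∣ᵣ + ∣ y ∣ᵣ
  ∣x+y∣≤∣x∣+∣y∣ x y = ⊔-lub (+-mono-≤ (x≤∣x∣ x) (x≤∣x∣ y))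
    (≤-respˡ-≈ (solve 2 (λ x y → :- x :+ :- y := :- (x :+ y)) ≈-refl x y)
      (+-mono-≤ (-x≤∣x∣ x) (-x≤∣x∣ y)))

  ∣x-y∣≤∣x∣+∣y∣ : ∀ x y → ∣ x - y ∣ᵣ ≤ ∣ x ∣ᵣ + ∣ y ∣ᵣ
  ∣x-y∣≤∣x∣+∣y∣ x y =
    ≤-respʳ-≈ (+-congˡ (∣-x∣≈∣x∣ y)) (∣x+y∣≤∣x∣+∣y∣ x (- y))

  ∣a*x∣≈a*∣x∣ : ∀ {a} x → 0# ≤ a → ∣ a * x ∣ᵣ ≈ a * ∣ x ∣ᵣ
  ∣a*x∣≈a*∣x∣ {a} x 0≤a with total 0# x
  ... | inj₁ 0≤x = ≈-trans (∣x∣≈x (*-nonNeg 0≤a 0≤x)) (*-congˡ (≈-sym (∣x∣≈x 0≤x)))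
  ... | inj₂ x≤0 = begin
    ∣ a * x ∣ᵣ      ≈⟨ ∣-x∣≈∣x∣ _ ⟨
    ∣ - (a * x) ∣ᵣ  ≈⟨ ∣∣-cong (-‿distribʳ-* a x) ⟩
    ∣ a * - x ∣ᵣ    ≈⟨ ∣x∣≈x (*-nonNeg 0≤a (neg-nonNeg x≤0)) ⟩
    a * - x         ≈⟨ *-congˡ (∣x∣≈x (neg-nonNeg x≤0)) ⟨
    a * ∣ - x ∣ᵣ    ≈⟨ *-congˡ (∣-x∣≈∣x∣ x) ⟩
    a * ∣ x ∣ᵣ      ∎
    where open ≈-Reasoning

  ∣x*y∣≈∣x∣*∣y∣ : ∀ x y → ∣ x * y ∣ᵣ ≈ ∣ x ∣ᵣ * ∣ y ∣ᵣ
  ∣x*y∣≈∣x∣*∣y∣ x y with total 0# x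
  ... | inj₁ 0≤x = ≈-trans (∣a*x∣≈a*∣x∣ y 0≤x) (*-congʳ (≈-sym (∣x∣≈x 0≤x)))
  ... | inj₂ x≤0 = begin
    ∣ x * y ∣ᵣ         ≈⟨ ∣-x∣≈∣x∣ _ ⟨
    ∣ - (x * y) ∣ᵣ     ≈⟨ ∣∣-cong (-‿distribˡ-* x y) ⟩
    ∣ - x * y ∣ᵣ       ≈⟨ ∣a*x∣≈a*∣x∣ y (neg-nonNeg x≤0) ⟩
    - x * ∣ y ∣ᵣ       ≈⟨ *-congʳ (∣x∣≈x (neg-nonNeg x≤0)) ⟨
    ∣ - x ∣ᵣ * ∣ y ∣ᵣ  ≈⟨ *-congʳ (∣-x∣≈∣x∣ x) ⟩
    ∣ x ∣ᵣ * ∣ y ∣ᵣ    ∎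
    where open ≈-Reasoning

  -- Finite sums

  sum-mono-≤ : ∀ {n} {f g : Fin n → Carrier} → (∀ i → f i ≤ g i) → sum f ≤ sum g
  sum-mono-≤ {zero}  f≤g = ≤-refl
  sum-mono-≤ {suc n} f≤g = +-mono-≤ (f≤g zero) (sum-mono-≤ (f≤g ∘ suc))

  sum-zero : ∀ {n} {f : Fin n → Carrier} → (∀ i → f i ≈ 0#) → sum f ≈ 0#
  sum-zero {n} f≈0 = ≈-trans (sum-cong-≋ f≈0) (sum-replicate-zero n)

  sum-nonNeg : ∀ {n} {f : Fin n → Carrier} → (∀ i → 0# ≤ f i) → 0# ≤ sum f
  sum-nonNeg {n} 0≤f = ≤-respˡ-≈ (sum-replicate-zero n) (sum-mono-≤ 0≤f)

  term≤sum : ∀ {n} {f : Fin n → Carrier} → (∀ i → 0# ≤ f i) → ∀ i → f i ≤ sum f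
  term≤sum 0≤f zero    = ≤-via-gap _ (sum-nonNeg (0≤f ∘ suc)) ≈-refl
  term≤sum 0≤f (suc i) = ≤-trans (term≤sum (0≤f ∘ suc) i)
    (≤-via-gap _ (0≤f zero) (+-comm _ _))

  sum-sub : ∀ {n} (f g : Fin n → Carrier) → ∑[ i < n ] (f i - g i) ≈ sum f - sum g
  sum-sub {zero}  f g = ≈-sym (-‿inverseʳ 0#)
  sum-sub {suc n} f g = ≈-trans (+-congˡ (sum-sub (f ∘ suc) (g ∘ suc)))
    (solve 4 (λ a b x y → a :- b :+ (x :- y) := a :+ x :- (b :+ y)) ≈-refl _ _ _ _)

  ∣sum∣≤sum∣∣ : ∀ {n} (f : Fin n → Carrier) → ∣ sum f ∣ᵣ ≤ ∑[ i < n ] ∣ f i ∣ᵣ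
  ∣sum∣≤sum∣∣ {zero}  f = ≤-reflexive (∣x∣≈x ≤-refl)
  ∣sum∣≤sum∣∣ {suc n} f = ≤-trans (∣x+y∣≤∣x∣+∣y∣ _ _) (+-monoʳ-≤ _ (∣sum∣≤sum∣∣ (f ∘ suc)))

  -- The same conditional as in `P ^ zero`, so the entries of the identity matrix are indicators by
  -- computation.
  𝟙 : Bool → Carrier
  𝟙 b = if b then 1# else 0#

  𝟙-nonNeg : ∀ b → 0# ≤ 𝟙 b
  𝟙-nonNeg true  = 0≤1
  𝟙-nonNeg false = ≤-refl

  𝟙-cases : ∀ {a} {A : Set a} (A? : Dec A) →
            (A × 𝟙 (does A?) ≡ 1#) ⊎ (¬ A × 𝟙 (does A?) ≡ 0#)
  𝟙-cases (yes a) = inj₁ (a , ≡.refl)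
  𝟙-cases (no ¬a) = inj₂ (¬a , ≡.refl)

  sum-𝟙-≟ : ∀ {n} (a : Fin n) (f : Fin n → Carrier) →
            ∑[ i < n ] (𝟙 (does (a Fin.≟ i)) * f i) ≈ f a
  sum-𝟙-≟ zero    f = ≈-trans
    (+-cong (*-identityˡ _) (sum-zero (λ i → zeroˡ (f (suc i))))) (+-identityʳ _)
  sum-𝟙-≟ (suc a) f = ≈-trans (+-cong (zeroˡ _) (sum-𝟙-≟ a (f ∘ suc))) (+-identityˡ _)

  -- Natural numbers

  fromℕ-+ : ∀ m n → fromℕ (m ℕ.+ n) ≈ fromℕ m + fromℕ n
  fromℕ-+ = ×-homo-+ 1#

  fromℕ-nonNeg : ∀ n → 0# ≤ fromℕ n
  fromℕ-nonNeg zero    = ≤-refl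
  fromℕ-nonNeg (suc n) = +-nonNeg 0≤1 (fromℕ-nonNeg n)

  fromℕ-mono-≤ : ∀ {m n} → m ℕ.≤ n → fromℕ m ≤ fromℕ n
  fromℕ-mono-≤ {m} {n} m≤n = ≤-via-gap (fromℕ (n ℕ.∸ m)) (fromℕ-nonNeg (n ℕ.∸ m))
    (≈-trans (≈-reflexive (≡.cong fromℕ (≡.sym (ℕ.m+[n∸m]≡n m≤n)))) (fromℕ-+ m (n ℕ.∸ m)))

  fromℕ-pos : ∀ n → 0# < fromℕ (suc n)
  fromℕ-pos n = pos (fromℕ-nonNeg (suc n))
    λ 1+n≈0 → 0≉1 (≈-sym (nonNeg-sum-zero 0≤1 (fromℕ-nonNeg n) 1+n≈0))

  fromℕ-length-filter-∷ : ∀ {a p} {A : Set a} {Q : Pred A p} (Q? : Decidable Q) x xs →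
    fromℕ (length (filter Q? (x ∷ xs))) ≈ 𝟙 (does (Q? x)) + fromℕ (length (filter Q? xs))
  fromℕ-length-filter-∷ Q? x xs with does (Q? x)
  ... | true  = ≈-refl
  ... | false = ≈-sym (+-identityˡ _)

  fromℕ-length-filter-tabulate :
    ∀ {a p n} {A : Set a} {Q : Pred A p} (Q? : Decidable Q) (f : Fin n → A) →
    fromℕ (length (filter Q? (tabulate f))) ≈ ∑[ i < n ] 𝟙 (does (Q? (f i)))
  fromℕ-length-filter-tabulate {n = zero}  Q? f = ≈-refl
  fromℕ-length-filter-tabulate {n = suc n} Q? f = ≈-trans
    (fromℕ-length-filter-∷ Q? (f zero) (tabulate (f ∘ suc)))
    (+-congˡ (fromℕ-length-filter-tabulate Q? (f ∘ suc)))

  -- The fibres of `g` partition the list: each `x` contributes only to the term `u = g x`.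
  sum-fromℕ-length-filter-≟ : ∀ {a n} {A : Set a} (g : A → Fin n) (xs : List A) →
    ∑[ u < n ] fromℕ (length (filter (λ x → g x Fin.≟ u) xs)) ≈ fromℕ (length xs)
  sum-fromℕ-length-filter-≟ {n = n} g [] = sum-replicate-zero n
  sum-fromℕ-length-filter-≟ {n = n} g (x ∷ xs) = begin
    ∑[ u < n ] fromℕ (length (filter (λ x → g x Fin.≟ u) (x ∷ xs)))
      ≈⟨ sum-cong-≋ (λ u → fromℕ-length-filter-∷ (λ x → g x Fin.≟ u) x xs) ⟩
    ∑[ u < n ] (𝟙 (does (g x Fin.≟ u)) + fromℕ (length (filter (λ x → g x Fin.≟ u) xs)))
      ≈⟨ ∑-distrib-+ {n} _ _ ⟩
    ∑[ u < n ] 𝟙 (does (g x Fin.≟ u)) + ∑[ u < n ] fromℕ (length (filter (λ x → g x Fin.≟ u) xs))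
      ≈⟨ +-cong (sum-cong-≋ (λ u → ≈-sym (*-identityʳ (𝟙 (does (g x Fin.≟ u))))))
                (sum-fromℕ-length-filter-≟ g xs) ⟩
    ∑[ u < n ] (𝟙 (does (g x Fin.≟ u)) * 1#) + fromℕ (length xs)
      ≈⟨ +-congʳ (sum-𝟙-≟ (g x) (λ _ → 1#)) ⟩
    1# + fromℕ (length xs)
      ∎
    where open ≈-Reasoning

does-≟-sym : ∀ {n} (i j : Fin n) → does (i Fin.≟ j) ≡ does (j Fin.≟ i)
does-≟-sym zero    zero    = ≡.refl
does-≟-sym zero    (suc j) = ≡.refl
does-≟-sym (suc i) zero    = ≡.refl
does-≟-sym (suc i) (suc j) = does-≟-sym i j

-- The ℓ¹ norm and partial sums of contracting sequences

module Norm {c ℓ₁ ℓ₂} (ℛ : Reals c ℓ₁ ℓ₂) where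

  open Reals ℛ
  open OrderedField ℛ

  ‖_‖₁ : ∀ {n} → (Fin n → Carrier) → Carrier
  ‖_‖₁ {n} f = ∑[ i < n ] ∣ f i ∣ᵣ

  ‖‖₁-cong : ∀ {n} {f g : Fin n → Carrier} → (∀ i → f i ≈ g i) → ‖ f ‖₁ ≈ ‖ g ‖₁
  ‖‖₁-cong f≈g = sum-cong-≋ (λ i → ∣∣-cong (f≈g i))

  ‖‖₁-nonNeg : ∀ {n} (f : Fin n → Carrier) → 0# ≤ ‖ f ‖₁
  ‖‖₁-nonNeg f = sum-nonNeg (λ i → ∣∣-nonNeg (f i))

  -- Associativity of row times matrix times column.
  ∑-assoc : ∀ {m n} (a : Fin m → Carrier) (B : Fin m → Fin n → Carrier) (d : Fin n → Carrier) →
    ∑[ x < n ] ((∑[ v < m ] (a v * B v x)) * d x) ≈ ∑[ v < m ] (a v * (∑[ x < n ] (B v x * d x)))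
  ∑-assoc {m} {n} a B d = begin
    ∑[ x < n ] ((∑[ v < m ] (a v * B v x)) * d x)
      ≈⟨ sum-cong-≋ (λ x → *-distribʳ-sum (d x) (λ v → a v * B v x)) ⟩
    ∑[ x < n ] ∑[ v < m ] (a v * B v x * d x)
      ≈⟨ ∑-comm (λ x v → a v * B v x * d x) ⟩
    ∑[ v < m ] ∑[ x < n ] (a v * B v x * d x)
      ≈⟨ sum-cong-≋ (λ v → sum-cong-≋ (λ x → *-assoc (a v) (B v x) (d x))) ⟩
    ∑[ v < m ] ∑[ x < n ] (a v * (B v x * d x))
      ≈⟨ sum-cong-≋ (λ v → *-distribˡ-sum (a v) (λ x → B v x * d x)) ⟨
    ∑[ v < m ] (a v * (∑[ x < n ] (B v x * d x)))
      ∎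
    where open ≈-Reasoning

  -- Applied with `M = P ^ s` and `b = 1#` it shows that distances to `π` never grow; with
  -- `M = dev t` it gives the contraction.
  ‖ξM‖₁≤b‖ξ‖₁ : ∀ {m n} b (ξ : Fin m → Carrier) (M : Fin m → Fin n → Carrier) →
    (∀ v → ‖ M v ‖₁ ≤ b) → ‖ (λ u → ∑[ v < m ] (ξ v * M v u)) ‖₁ ≤ b * ‖ ξ ‖₁
  ‖ξM‖₁≤b‖ξ‖₁ {m} {n} b ξ M ‖M‖≤b = begin
    ∑[ u < n ] ∣ ∑[ v < m ] (ξ v * M v u) ∣ᵣ
      ≤⟨ sum-mono-≤ (λ u → ∣sum∣≤sum∣∣ (λ v → ξ v * M v u)) ⟩
    ∑[ u < n ] ∑[ v < m ] ∣ ξ v * M v u ∣ᵣ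
      ≈⟨ ∑-comm (λ u v → ∣ ξ v * M v u ∣ᵣ) ⟩
    ∑[ v < m ] ∑[ u < n ] ∣ ξ v * M v u ∣ᵣ
      ≈⟨ sum-cong-≋ (λ v → sum-cong-≋ (λ u → ∣x*y∣≈∣x∣*∣y∣ (ξ v) (M v u))) ⟩
    ∑[ v < m ] ∑[ u < n ] (∣ ξ v ∣ᵣ * ∣ M v u ∣ᵣ)
      ≈⟨ sum-cong-≋ (λ v → *-distribˡ-sum ∣ ξ v ∣ᵣ (λ u → ∣ M v u ∣ᵣ)) ⟨
    ∑[ v < m ] (∣ ξ v ∣ᵣ * ‖ M v ‖₁)
      ≤⟨ sum-mono-≤ (λ v → *-monoˡ-≤ (∣∣-nonNeg (ξ v)) (‖M‖≤b v)) ⟩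
    ∑[ v < m ] (∣ ξ v ∣ᵣ * b)
      ≈⟨ *-distribʳ-sum b (λ v → ∣ ξ v ∣ᵣ) ⟨
    ‖ ξ ‖₁ * b
      ≈⟨ *-comm _ _ ⟩
    b * ‖ ξ ‖₁
      ∎
    where open ≤-Reasoning

  -- The recursion advances the start `s`, as does the telescoping in `∣transported-μ∣≤`, where each
  -- step trades one unit of `T` for one of `s`.
  partialSum : (ℕ → Carrier) → ℕ → ℕ → Carrier
  partialSum d s zero    = 0#
  partialSum d s (suc T) = d s + partialSum d (suc s) T

  module _ {d : ℕ → Carrier} (0≤d : ∀ s → 0# ≤ d s) where

    partialSum-nonNeg : ∀ s T → 0# ≤ partialSum d s T
    partialSum-nonNeg s zero    = ≤-refl
    partialSum-nonNeg s (suc T) = +-nonNeg (0≤d s) (partialSum-nonNeg (suc s) T)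

    partialSum-suc : ∀ s T → partialSum d s T ≤ partialSum d s (suc T)
    partialSum-suc s zero    = partialSum-nonNeg s 1
    partialSum-suc s (suc T) = +-monoʳ-≤ (d s) (partialSum-suc (suc s) T)

    -- The window keeps its length `T` while its start moves by `m`. The terms gained at the far end
    -- are nonnegative, so `T` need not be compared with `m`.
    partialSum-shift : ∀ {b} m s T → (∀ j → d (j ℕ.+ s) ≤ b) →
      partialSum d s T ≤ fromℕ m * b + partialSum d (m ℕ.+ s) T
    partialSum-shift zero s T d≤b =
      ≤-reflexive (≈-sym (≈-trans (+-congʳ (zeroˡ _)) (+-identityˡ _)))
    partialSum-shift {b} (suc m) s T d≤b = begin
      partialSum d s T
        ≤⟨ partialSum-suc s T ⟩
      d s + partialSum d (suc s) T
        ≤⟨ +-mono-≤ (d≤b 0) (partialSum-shift m (suc s) T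
             (λ j → ≡.subst (λ k → d k ≤ b) (≡.sym (ℕ.+-suc j s)) (d≤b (suc j)))) ⟩
      b + (fromℕ m * b + partialSum d (m ℕ.+ suc s) T)
        ≡⟨ ≡.cong (λ k → b + (fromℕ m * b + partialSum d k T)) (ℕ.+-suc m s) ⟩
      b + (fromℕ m * b + partialSum d (suc m ℕ.+ s) T)
        ≈⟨ solve 3 (λ b m r → b :+ (m :* b :+ r) := (con (+ 1) :+ m) :* b :+ r) ≈-refl b (fromℕ m) _ ⟩
      fromℕ (suc m) * b + partialSum d (suc m ℕ.+ s) T
        ∎
      where open ≤-Reasoning

    module _ {h} t (2h≈1 : h + h ≈ 1#) (d[t+s]≤h*d : ∀ s → d (t ℕ.+ s) ≤ h * d s) where

      partialSum-contract : ∀ s T → partialSum d (t ℕ.+ s) T ≤ h * partialSum d s T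
      partialSum-contract s zero    = ≤-reflexive (≈-sym (zeroʳ h))
      partialSum-contract s (suc T) = ≤-respʳ-≈ (≈-sym (distribˡ h _ _))
        (+-mono-≤ (d[t+s]≤h*d s)
          (≡.subst (λ k → partialSum d k T ≤ h * partialSum d (suc s) T) (ℕ.+-suc t s)
            (partialSum-contract (suc s) T)))

      -- Past t the partial sum U satisfies U ≤ t h + h U.
      partialSum≤3t : (∀ s → d s ≤ 1# + 1#) → (∀ s → d (s ℕ.+ t) ≤ h) →
        ∀ T → partialSum d 0 T ≤ fromℕ 3 * fromℕ t
      partialSum≤3t d≤2 d≤h T = begin
        partialSum d 0 T
          ≤⟨ partialSum-shift t 0 T (λ j → d≤2 (j ℕ.+ 0)) ⟩
        x * (1# + 1#) + partialSum d (t ℕ.+ 0) T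
          ≡⟨ ≡.cong (λ k → x * (1# + 1#) + partialSum d k T) (ℕ.+-identityʳ t) ⟩
        x * (1# + 1#) + U
          ≤⟨ +-monoʳ-≤ _ U≤x ⟩
        x * (1# + 1#) + x
          -- The three is spelled out because `fromℕ 3` unfolds to `1# + (1# + (1# + 0#))`.
          ≈⟨ solve 1 (λ x → x :* (con (+ 1) :+ con (+ 1)) :+ x :=
               (con (+ 1) :+ (con (+ 1) :+ (con (+ 1) :+ con (+ 0)))) :* x) ≈-refl x ⟩
        fromℕ 3 * x
          ∎
        where
        open ≤-Reasoning
        x = fromℕ t
        U = partialSum d t T
        U≤hx+hU : U ≤ x * h + h * U
        U≤hx+hU = ≤-trans (partialSum-shift t t T d≤h) (+-monoʳ-≤ _ (partialSum-contract t T))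
        -- Doubling turns the factors `h` into `1#`, after which one `U` cancels without any
        -- division.
        U≤x : U ≤ x
        U≤x = begin
          U
            ≈⟨ solve 1 (λ u → u := u :+ u :- u) ≈-refl U ⟩
          U + U - U
            ≤⟨ +-monoˡ-≤ (- U) (+-mono-≤ U≤hx+hU U≤hx+hU) ⟩
          (x * h + h * U) + (x * h + h * U) - U
            ≈⟨ solve 3 (λ x u h → (x :* h :+ h :* u) :+ (x :* h :+ h :* u) :- u :=
                 (h :+ h) :* (x :+ u) :- u) ≈-refl x U h ⟩
          (h + h) * (x + U) - U
            ≈⟨ +-congʳ (*-congʳ 2h≈1) ⟩
          1# * (x + U) - U
            ≈⟨ solve 2 (λ x u → con (+ 1) :* (x :+ u) :- u := x) ≈-refl x U ⟩
          x
            ∎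

-- Powers of the transition matrix

module Chain {c ℓ₁ ℓ₂} (ℛ : Reals c ℓ₁ ℓ₂) {N : ℕ} where

  open Reals ℛ
  open Routing ℛ
  open OrderedField ℛ
  open Norm ℛ

  module Stochastic {P : Matrix N} (stochastic : IsStochastic P) where

    P-nonNeg : ∀ u v → 0# ≤ P u v
    P-nonNeg = proj₁ stochastic

    P-rowSum : ∀ u → sum (P u) ≈ 1#
    P-rowSum = proj₂ stochastic

    P≤1 : ∀ u v → P u v ≤ 1#
    P≤1 u v = ≤-respʳ-≈ (P-rowSum u) (term≤sum (P-nonNeg u) v)

    ^-nonNeg : ∀ t u v → 0# ≤ (P ^ t) u v
    ^-nonNeg zero    u v = 𝟙-nonNeg (does (u Fin.≟ v))
    ^-nonNeg (suc t) u v = sum-nonNeg (λ x → *-nonNeg (^-nonNeg t u x) (P-nonNeg x v))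

    sum-𝟙-≟ʳ : ∀ (f : Fin N → Carrier) w → ∑[ v < N ] (f v * (P ^ 0) v w) ≈ f w
    sum-𝟙-≟ʳ f w = ≈-trans
      (sum-cong-≋ (λ v → ≈-trans (*-comm _ _)
        (*-congʳ (≈-reflexive (≡.cong 𝟙 (does-≟-sym v w))))))
      (sum-𝟙-≟ w f)

    ^-+ : ∀ s t u w → (P ^ (s ℕ.+ t)) u w ≈ ∑[ v < N ] ((P ^ t) u v * (P ^ s) v w)
    ^-+ zero    t u w = ≈-sym (sum-𝟙-≟ʳ ((P ^ t) u) w)
    ^-+ (suc s) t u w = ≈-trans
      (sum-cong-≋ (λ x → *-congʳ (^-+ s t u x)))
      (∑-assoc ((P ^ t) u) (P ^ s) (λ x → P x w))

    -- Powers are defined with the new factor on the right; reversing a path, or splitting off its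
    -- first step, needs it on the left.
    ^-sucˡ : ∀ t u w → (P ^ suc t) u w ≈ ∑[ v < N ] (P u v * (P ^ t) v w)
    ^-sucˡ t u w = begin
      (P ^ suc t) u w
        ≡⟨ ≡.cong (λ k → (P ^ k) u w) (ℕ.+-comm 1 t) ⟩
      (P ^ (t ℕ.+ 1)) u w
        ≈⟨ ^-+ t 1 u w ⟩
      ∑[ v < N ] ((P ^ 1) u v * (P ^ t) v w)
        ≈⟨ sum-cong-≋ (λ v → *-congʳ (sum-𝟙-≟ u (λ x → P x v))) ⟩
      ∑[ v < N ] (P u v * (P ^ t) v w)
        ∎
      where open ≈-Reasoning

    ^-rowSum : ∀ t u → sum ((P ^ t) u) ≈ 1#
    ^-rowSum zero    u = ≈-trans
      (sum-cong-≋ (λ w → ≈-sym (*-identityʳ ((P ^ 0) u w)))) (sum-𝟙-≟ u (λ _ → 1#))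
    ^-rowSum (suc t) u = begin
      ∑[ w < N ] ∑[ v < N ] ((P ^ t) u v * P v w)
        ≈⟨ ∑-comm (λ w v → (P ^ t) u v * P v w) ⟩
      ∑[ v < N ] ∑[ w < N ] ((P ^ t) u v * P v w)
        ≈⟨ sum-cong-≋ (λ v → *-distribˡ-sum ((P ^ t) u v) (P v)) ⟨
      ∑[ v < N ] ((P ^ t) u v * sum (P v))
        ≈⟨ sum-cong-≋ (λ v → ≈-trans (*-congˡ (P-rowSum v)) (*-identityʳ _)) ⟩
      sum ((P ^ t) u)
        ≈⟨ ^-rowSum t u ⟩
      1#
        ∎
      where open ≈-Reasoning

  -- Deviation from stationarity and its decay

  module Reversible {P : Matrix N} {π : Fin N → Carrier}
    (stochastic : IsStochastic P) (stationary : IsStationary P π)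
    (reversible : IsReversible P π) where

    open Stochastic stochastic public

    π-nonNeg : ∀ v → 0# ≤ π v
    π-nonNeg = proj₁ stationary

    π-sum : sum π ≈ 1#
    π-sum = proj₁ (proj₂ stationary)

    -- Detailed balance carries the weight `π` along a path one edge at a time. The last edge of the
    -- path becomes the first of its reversal, hence the appeal to `^-sucˡ`.
    ^-reversible : ∀ t u w → π u * (P ^ t) u w ≈ π w * (P ^ t) w u
    ^-reversible zero u w with u Fin.≟ w | w Fin.≟ u
    ... | yes ≡.refl | yes _   = ≈-refl
    ... | no _       | no _    = ≈-trans (zeroʳ _) (≈-sym (zeroʳ _))
    ... | yes u≡w    | no w≢u  = contradiction (≡.sym u≡w) w≢u
    ... | no u≢w     | yes w≡u = contradiction (≡.sym w≡u) u≢w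
    ^-reversible (suc t) u w = begin
      π u * (∑[ v < N ] ((P ^ t) u v * P v w))
        ≈⟨ *-distribˡ-sum (π u) (λ v → (P ^ t) u v * P v w) ⟩
      ∑[ v < N ] (π u * ((P ^ t) u v * P v w))
        ≈⟨ sum-cong-≋ swap ⟩
      ∑[ v < N ] (π w * (P w v * (P ^ t) v u))
        ≈⟨ *-distribˡ-sum (π w) (λ v → P w v * (P ^ t) v u) ⟨
      π w * (∑[ v < N ] (P w v * (P ^ t) v u))
        ≈⟨ *-congˡ (^-sucˡ t w u) ⟨
      π w * (P ^ suc t) w u
        ∎
      where
      open ≈-Reasoning
      swap : ∀ v → π u * ((P ^ t) u v * P v w) ≈ π w * (P w v * (P ^ t) v u)
      swap v = begin
        π u * ((P ^ t) u v * P v w)  ≈⟨ *-assoc _ _ _ ⟨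
        π u * (P ^ t) u v * P v w    ≈⟨ *-congʳ (^-reversible t u v) ⟩
        π v * (P ^ t) v u * P v w
          ≈⟨ solve 3 (λ a b d → a :* b :* d := a :* d :* b) ≈-refl (π v) _ (P v w) ⟩
        π v * P v w * (P ^ t) v u    ≈⟨ *-congʳ (reversible v w) ⟩
        π w * P w v * (P ^ t) v u    ≈⟨ *-assoc _ _ _ ⟩
        π w * (P w v * (P ^ t) v u)  ∎

    ^-stationary : ∀ t w → ∑[ v < N ] (π v * (P ^ t) v w) ≈ π w
    ^-stationary t w = begin
      ∑[ v < N ] (π v * (P ^ t) v w)  ≈⟨ sum-cong-≋ (λ v → ^-reversible t v w) ⟩
      ∑[ v < N ] (π w * (P ^ t) w v)  ≈⟨ *-distribˡ-sum (π w) ((P ^ t) w) ⟨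
      π w * sum ((P ^ t) w)           ≈⟨ *-congˡ (^-rowSum t w) ⟩
      π w * 1#                        ≈⟨ *-identityʳ _ ⟩
      π w                             ∎
      where open ≈-Reasoning

    -- The ℓ¹ norm of the row `dev t w` is twice the total variation distance to `π` at time `t`
    -- from the start `w`.
    dev : ℕ → Fin N → Fin N → Carrier
    dev t w u = (P ^ t) w u - π u

    dev-sum : ∀ t w → sum (dev t w) ≈ 0#
    dev-sum t w = ≈-trans (sum-sub ((P ^ t) w) π)
      (≈-trans (+-cong (^-rowSum t w) (-‿cong π-sum)) (-‿inverseʳ 1#))

    dev-^ : ∀ s t w u → dev (s ℕ.+ t) w u ≈ ∑[ v < N ] (dev t w v * (P ^ s) v u)
    dev-^ s t w u = begin
      (P ^ (s ℕ.+ t)) w u - π u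
        ≈⟨ +-cong (^-+ s t w u) (-‿cong (≈-sym (^-stationary s u))) ⟩
      ∑[ v < N ] ((P ^ t) w v * (P ^ s) v u) - ∑[ v < N ] (π v * (P ^ s) v u)
        ≈⟨ sum-sub (λ v → (P ^ t) w v * (P ^ s) v u) (λ v → π v * (P ^ s) v u) ⟨
      ∑[ v < N ] ((P ^ t) w v * (P ^ s) v u - π v * (P ^ s) v u)
        ≈⟨ sum-cong-≋ (λ v → solve 3 (λ a b d → a :* d :- b :* d := (a :- b) :* d) ≈-refl
             ((P ^ t) w v) (π v) ((P ^ s) v u)) ⟩
      ∑[ v < N ] (dev t w v * (P ^ s) v u)
        ∎
      where open ≈-Reasoning

    -- Since `dev t w` has total mass zero, the constant `π u` can be subtracted from every
    -- `(P ^ s) v u` in `dev-^`. This is the source of the geometric decay.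
    dev-+ : ∀ s t w u → dev (s ℕ.+ t) w u ≈ ∑[ v < N ] (dev t w v * dev s v u)
    dev-+ s t w u = begin
      dev (s ℕ.+ t) w u
        ≈⟨ dev-^ s t w u ⟩
      ∑[ v < N ] (dev t w v * (P ^ s) v u)
        ≈⟨ solve 2 (λ a b → a := a :- con (+ 0) :* b) ≈-refl _ (π u) ⟩
      ∑[ v < N ] (dev t w v * (P ^ s) v u) - 0# * π u
        ≈⟨ +-congˡ (-‿cong (*-congʳ (dev-sum t w))) ⟨
      ∑[ v < N ] (dev t w v * (P ^ s) v u) - sum (dev t w) * π u
        ≈⟨ +-congˡ (-‿cong (*-distribʳ-sum (π u) (dev t w))) ⟩
      ∑[ v < N ] (dev t w v * (P ^ s) v u) - ∑[ v < N ] (dev t w v * π u)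
        ≈⟨ sum-sub (λ v → dev t w v * (P ^ s) v u) (λ v → dev t w v * π u) ⟨
      ∑[ v < N ] (dev t w v * (P ^ s) v u - dev t w v * π u)
        ≈⟨ sum-cong-≋ (λ v → solve 3 (λ a b d → a :* b :- a :* d := a :* (b :- d)) ≈-refl
             (dev t w v) ((P ^ s) v u) (π u)) ⟩
      ∑[ v < N ] (dev t w v * dev s v u)
        ∎
      where open ≈-Reasoning

    ‖^‖₁≈1 : ∀ s w → ‖ (P ^ s) w ‖₁ ≈ 1#
    ‖^‖₁≈1 s w = ≈-trans (sum-cong-≋ (λ u → ∣x∣≈x (^-nonNeg s w u))) (^-rowSum s w)

    ‖dev‖₁≤2 : ∀ s w → ‖ dev s w ‖₁ ≤ 1# + 1#
    ‖dev‖₁≤2 s w = begin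
      ‖ dev s w ‖₁
        ≤⟨ sum-mono-≤ (λ u → ∣x-y∣≤∣x∣+∣y∣ ((P ^ s) w u) (π u)) ⟩
      ∑[ u < N ] (∣ (P ^ s) w u ∣ᵣ + ∣ π u ∣ᵣ)
        ≈⟨ ∑-distrib-+ (λ u → ∣ (P ^ s) w u ∣ᵣ) (λ u → ∣ π u ∣ᵣ) ⟩
      ‖ (P ^ s) w ‖₁ + ‖ π ‖₁
        ≈⟨ +-cong (‖^‖₁≈1 s w) (≈-trans (sum-cong-≋ (λ u → ∣x∣≈x (π-nonNeg u))) π-sum) ⟩
      1# + 1#
        ∎
      where open ≤-Reasoning

    -- The mixing rate is a maximum of hitting times over all starts, so closeness to `π` has to
    -- persist after a start's own `hit`.
    ‖dev‖₁-antitone : ∀ s t w → ‖ dev (s ℕ.+ t) w ‖₁ ≤ ‖ dev t w ‖₁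
    ‖dev‖₁-antitone s t w = begin
      ‖ dev (s ℕ.+ t) w ‖₁
        ≈⟨ ‖‖₁-cong (dev-^ s t w) ⟩
      ‖ (λ u → ∑[ v < N ] (dev t w v * (P ^ s) v u)) ‖₁
        ≤⟨ ‖ξM‖₁≤b‖ξ‖₁ 1# (dev t w) (P ^ s) (λ v → ≤-reflexive (‖^‖₁≈1 s v)) ⟩
      1# * ‖ dev t w ‖₁
        ≈⟨ *-identityˡ _ ⟩
      ‖ dev t w ‖₁
        ∎
      where open ≤-Reasoning

    ‖dev‖₁-contract : ∀ {h} t → (∀ v → ‖ dev t v ‖₁ ≤ h) →
      ∀ w s → ‖ dev (t ℕ.+ s) w ‖₁ ≤ h * ‖ dev s w ‖₁
    ‖dev‖₁-contract {h} t ‖dev‖≤h w s = ≤-respˡ-≈ (≈-sym (‖‖₁-cong (dev-+ t s w)))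
      (‖ξM‖₁≤b‖ξ‖₁ h (dev s w) (dev t) ‖dev‖≤h)

    ½ : Carrier
    ½ = 1# / fromℕ 2

    ½+½≈1 : ½ + ½ ≈ 1#
    ½+½≈1 = begin
      ½ + ½
        ≈⟨ solve 1 (λ x → x :+ x := x :* (con (+ 1) :+ (con (+ 1) :+ con (+ 0)))) ≈-refl ½ ⟩
      ½ * fromℕ 2
        ≈⟨ /-*-cancel (fromℕ-pos 1) ⟩
      1#
        ∎
      where open ≈-Reasoning

    ¼+¼≈½ : 1# / fromℕ 4 + 1# / fromℕ 4 ≈ ½
    ¼+¼≈½ = begin
      ¼ + ¼
        ≈⟨ *-identityˡ _ ⟨
      1# * (¼ + ¼)
        ≈⟨ *-congʳ ½+½≈1 ⟨
      (½ + ½) * (¼ + ¼)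
        ≈⟨ solve 2 (λ h q → (h :+ h) :* (q :+ q) :=
             h :* (q :* (con (+ 1) :+ (con (+ 1) :+ (con (+ 1) :+ (con (+ 1) :+ con (+ 0)))))))
             ≈-refl ½ ¼ ⟩
      ½ * (¼ * fromℕ 4)
        ≈⟨ *-congˡ (/-*-cancel (fromℕ-pos 3)) ⟩
      ½ * 1#
        ≈⟨ *-identityʳ ½ ⟩
      ½
        ∎
      where
      open ≈-Reasoning
      ¼ = 1# / fromℕ 4

    ‖dev‖₁-mixed : ∀ {t*} → IsMixingRate P π t* → ∀ v → ‖ dev t* v ‖₁ ≤ ½
    ‖dev‖₁-mixed (hit , least , ≡.refl) v = begin
      ‖ dev (maxℕ hit) v ‖₁
        ≡⟨ ≡.cong (λ k → ‖ dev k v ‖₁) (ℕ.m∸n+n≡m hit≤max) ⟨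
      ‖ dev (maxℕ hit ℕ.∸ hit v ℕ.+ hit v) v ‖₁
        ≤⟨ ‖dev‖₁-antitone (maxℕ hit ℕ.∸ hit v) (hit v) v ⟩
      x
        ≈⟨ ≈-trans (≈-sym (*-identityˡ x)) (*-congʳ (≈-sym ½+½≈1)) ⟩
      (½ + ½) * x
        ≈⟨ distribʳ x ½ ½ ⟩
      -- Each summand is by definition the `dTV` that `hit v` brings down to a quarter.
      ½ * x + ½ * x
        ≤⟨ +-mono-≤ (proj₁ (least v)) (proj₁ (least v)) ⟩
      1# / fromℕ 4 + 1# / fromℕ 4
        ≈⟨ ¼+¼≈½ ⟩
      ½
        ∎
      where
      open ≤-Reasoning
      x = ‖ dev (hit v) v ‖₁
      hit≤max : hit v ℕ.≤ maxℕ hit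
      hit≤max = All.tabulate⁻ (Extrema.xs≤max ℕ.≤-totalOrder 0 (tabulate hit)) v

    partialSum-‖dev‖₁ : ∀ {t*} → IsMixingRate P π t* →
      ∀ w T → partialSum (λ s → ‖ dev s w ‖₁) 0 T ≤ fromℕ 3 * fromℕ t*
    partialSum-‖dev‖₁ {t*} mixing w = partialSum≤3t (λ s → ‖‖₁-nonNeg (dev s w)) t* ½+½≈1
      (‖dev‖₁-contract t* (‖dev‖₁-mixed mixing) w)
      (λ s → ‖dev‖₁≤2 s w)
      (λ s → ≤-trans (‖dev‖₁-antitone s t* w) (‖dev‖₁-mixed mixing w))

    -- Positivity of the stationary distribution; from columns to rows

    module Irreducible (irreducible : IsIrreducible P) where

      -- If `π w` vanished, detailed balance along a path of positive probability from `u` to `w`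
      -- would make `π u` vanish for every `u`, yet `π` sums to one.
      π-pos : ∀ w → 0# < π w
      π-pos w = pos (π-nonNeg w) λ πw≈0 → 0≉1
        (≈-trans (≈-sym (sum-zero (λ u → let t , 0<Pᵗuw = irreducible u w in
          *-cancel-zero (pos⇒nonZero 0<Pᵗuw)
            (≈-trans (^-reversible t u w) (≈-trans (*-congʳ πw≈0) (zeroˡ _)))))) π-sum)

      πmin-pos : 0# < πmin π
      -- The base value `1#` of the minimum must be positive as well.
      πmin-pos = Extrema.v<min⁺ totalOrder (0≤1 , 0≉1) (All.tabulate⁺ π-pos)

      πmin≤π : ∀ v → πmin π ≤ π v
      πmin≤π = All.tabulate⁻ (Extrema.min≤xs totalOrder 1# (tabulate π))

      -- Makes adjacency symmetric, so that `Δ P`, defined by outgoing neighbours, also bounds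
      -- incoming ones.
      P-pos-sym : ∀ {u v} → 0# < P u v → 0# < P v u
      P-pos-sym {u} {v} 0<Puv = pos (P-nonNeg v u) λ Pvu≈0 →
        pos⇒nonZero (π-pos u) (*-cancel-zero (pos⇒nonZero 0<Puv)
          (≈-trans (reversible u v) (≈-trans (*-congˡ Pvu≈0) (zeroʳ _))))

      -- Detailed balance gives `π u * y ≈ π w * z` for the column entry `y` and the row entry `z`;
      -- then `π u` is bounded below by `πmin π`.
      ∣^-π∣≤ : ∀ s u w → ∣ (P ^ s) u w - π w ∣ᵣ ≤ π w / πmin π * ∣ dev s w u ∣ᵣ
      ∣^-π∣≤ s u w = begin
        ∣ y ∣ᵣ
          ≈⟨ *-identityˡ _ ⟨
        1# * ∣ y ∣ᵣ
          ≈⟨ *-congʳ (≈-sym (*-inverseʳ (pos⇒nonZero πmin-pos))) ⟩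
        m * m ⁻¹ * ∣ y ∣ᵣ
          ≈⟨ solve 3 (λ m i y → m :* i :* y := i :* (m :* y)) ≈-refl m (m ⁻¹) ∣ y ∣ᵣ ⟩
        m ⁻¹ * (m * ∣ y ∣ᵣ)
          ≤⟨ *-monoˡ-≤ (pos⇒⁻¹-nonNeg πmin-pos) (*-monoʳ-≤ (∣∣-nonNeg y) (πmin≤π u)) ⟩
        m ⁻¹ * (π u * ∣ y ∣ᵣ)
          ≈⟨ *-congˡ (∣a*x∣≈a*∣x∣ y (π-nonNeg u)) ⟨
        m ⁻¹ * ∣ π u * y ∣ᵣ
          ≈⟨ *-congˡ (∣∣-cong πy≈πz) ⟩
        m ⁻¹ * ∣ π w * z ∣ᵣ
          ≈⟨ *-congˡ (∣a*x∣≈a*∣x∣ z (π-nonNeg w)) ⟩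
        m ⁻¹ * (π w * ∣ z ∣ᵣ)
          ≈⟨ solve 3 (λ i p z → i :* (p :* z) := p :* i :* z) ≈-refl (m ⁻¹) (π w) ∣ z ∣ᵣ ⟩
        π w / m * ∣ z ∣ᵣ
          ∎
        where
        open ≤-Reasoning
        m = πmin π
        y = (P ^ s) u w - π w
        z = dev s w u
        πy≈πz : π u * y ≈ π w * z
        πy≈πz = ≈-trans
          (solve 3 (λ a p b → a :* (p :- b) := a :* p :- a :* b) ≈-refl (π u) ((P ^ s) u w) (π w))
          (≈-trans (+-cong (^-reversible s u w) (-‿cong (*-comm _ _)))
            (solve 3 (λ b q a → b :* q :- b :* a := b :* (q :- a)) ≈-refl (π w) ((P ^ s) w u) (π u)))

-- Router counts and the discrepancy of the billiard router

length-filter-applyUpTo-+ : ∀ {a p} {A : Set a} {Q : Pred A p} (Q? : Decidable Q)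
  (f : ℕ → A) m n →
  length (filter Q? (applyUpTo f (m ℕ.+ n))) ≡
  length (filter Q? (applyUpTo f m)) ℕ.+ length (filter Q? (applyUpTo (f ∘ (m ℕ.+_)) n))
length-filter-applyUpTo-+ Q? f zero    n = ≡.refl
length-filter-applyUpTo-+ Q? f (suc m) n with does (Q? (f 0))
... | true  = ≡.cong suc (length-filter-applyUpTo-+ Q? (f ∘ suc) m n)
... | false = length-filter-applyUpTo-+ Q? (f ∘ suc) m n

module Routers {c ℓ₁ ℓ₂} (ℛ : Reals c ℓ₁ ℓ₂) {N : ℕ} where

  open Reals ℛ
  open Routing ℛ
  open OrderedField ℛ
  open import Algebra.Properties.Semiring.Sum ℕ.+-*-semiring using () renaming (sum to sumℕ)

  -- The adjacency matrix of `P` with entries in the field, so that degrees are its row sums.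
  nbr : Matrix N → Fin N → Fin N → Carrier
  nbr P v u = 𝟙 (does (0# <? P v u))

  nbr-cases : ∀ (P : Matrix N) v u →
    (0# < P v u × nbr P v u ≡ 1#) ⊎ (¬ 0# < P v u × nbr P v u ≡ 0#)
  nbr-cases P v u = 𝟙-cases (0# <? P v u)

  fromℕ-δ : ∀ (P : Matrix N) v → fromℕ (δ P v) ≈ sum (nbr P v)
  fromℕ-δ P v = fromℕ-length-filter-tabulate (λ u → 0# <? P v u) id

  δ≤Δ : ∀ (P : Matrix N) v → fromℕ (δ P v) ≤ fromℕ (Δ P)
  δ≤Δ P v = fromℕ-mono-≤
    (All.tabulate⁻ (Extrema.xs≤max ℕ.≤-totalOrder 0 (tabulate (δ P))) v)

  module Counting {P : Matrix N} (ρ : Router P) where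

    open Router ρ

    I-+ : ∀ v u z n → I ρ v u 0 (z ℕ.+ n) ≡ I ρ v u 0 z ℕ.+ I ρ v u z (z ℕ.+ n)
    I-+ v u z n rewrite ℕ.m+n∸m≡n z n =
      length-filter-applyUpTo-+ (λ j → σ v j Fin.≟ u) id z n

    fromℕ-I-suc : ∀ v u z →
      fromℕ (I ρ v u 0 (suc z)) ≈ fromℕ (I ρ v u 0 z) + 𝟙 (does (σ v z Fin.≟ u))
    fromℕ-I-suc v u z = begin
      fromℕ (I ρ v u 0 (suc z))
        ≡⟨ ≡.cong (λ k → fromℕ (I ρ v u 0 k)) (ℕ.+-comm 1 z) ⟩
      fromℕ (I ρ v u 0 (z ℕ.+ 1))
        ≡⟨ ≡.cong fromℕ (length-filter-applyUpTo-+ (λ j → σ v j Fin.≟ u) id z 1) ⟩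
      fromℕ (I ρ v u 0 z ℕ.+ length (filter (λ j → σ v j Fin.≟ u) [ z ℕ.+ 0 ]))
        ≈⟨ fromℕ-+ (I ρ v u 0 z) _ ⟩
      fromℕ (I ρ v u 0 z) + fromℕ (length (filter (λ j → σ v j Fin.≟ u) [ z ℕ.+ 0 ]))
        ≈⟨ +-congˡ (fromℕ-length-filter-∷ (λ j → σ v j Fin.≟ u) (z ℕ.+ 0) _) ⟩
      fromℕ (I ρ v u 0 z) + (𝟙 (does (σ v (z ℕ.+ 0) Fin.≟ u)) + 0#)
        ≈⟨ +-congˡ (+-identityʳ _) ⟩
      fromℕ (I ρ v u 0 z) + 𝟙 (does (σ v (z ℕ.+ 0) Fin.≟ u))
        ≡⟨ ≡.cong (λ k → fromℕ (I ρ v u 0 z) + 𝟙 (does (σ v k Fin.≟ u))) (ℕ.+-identityʳ z) ⟩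
      fromℕ (I ρ v u 0 z) + 𝟙 (does (σ v z Fin.≟ u))
        ∎
      where open ≈-Reasoning

    sum-I : ∀ v z n → ∑[ u < N ] fromℕ (I ρ v u z (z ℕ.+ n)) ≈ fromℕ n
    sum-I v z n = ≈-trans
      (sum-fromℕ-length-filter-≟ (σ v) (applyUpTo (z ℕ.+_) (z ℕ.+ n ℕ.∸ z)))
      (≈-reflexive (≡.cong fromℕ
        (≡.trans (length-applyUpTo (z ℕ.+_) (z ℕ.+ n ℕ.∸ z)) (ℕ.m+n∸m≡n z n))))

  -- After z steps the counts I v u 0 z are the floors of θ v z * P v u, up to
  -- ties: the billiard router lists the points k / P v u (k ≥ 1) in
  -- increasing order, θ v z being the next one.
  module Billiard {P : Matrix N} (stochastic : IsStochastic P)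
    (ρ : Router P) (billiard : IsBilliard ρ) where

    open Router ρ
    open Counting ρ
    open Chain ℛ using (module Stochastic)
    open Stochastic stochastic

    θ : Fin N → ℕ → Carrier
    θ v z = fromℕ (I ρ v (σ v z) 0 z ℕ.+ 1) / P v (σ v z)

    fromℕ-I+1 : ∀ v u z → fromℕ (I ρ v u 0 z ℕ.+ 1) ≈ fromℕ (I ρ v u 0 z) + 1#
    fromℕ-I+1 v u z = ≈-trans (fromℕ-+ (I ρ v u 0 z) 1) (+-congˡ (+-identityʳ 1#))

    I≤I-suc : ∀ v u z → fromℕ (I ρ v u 0 z ℕ.+ 1) ≤ fromℕ (I ρ v u 0 (suc z) ℕ.+ 1)
    I≤I-suc v u z = ≤-respˡ-≈ (≈-sym (fromℕ-I+1 v u z)) (≤-respʳ-≈ (≈-sym (fromℕ-I+1 v u (suc z)))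
      (+-monoˡ-≤ 1# (≤-via-gap _ (𝟙-nonNeg (does (σ v z Fin.≟ u))) (fromℕ-I-suc v u z))))

    -- The state chosen at `suc z` was already a candidate at `z`, and its count has not decreased
    -- since.
    θ-mono : ∀ v z → θ v z ≤ θ v (suc z)
    θ-mono v z = ≤-trans (billiard v z (σ v (suc z)) (σ∈𝒩 v (suc z)))
      (*-monoʳ-≤ (pos⇒⁻¹-nonNeg (σ∈𝒩 v (suc z))) (I≤I-suc v (σ v (suc z)) z))

    θ-nonNeg : ∀ v z → 0# ≤ θ v z
    θ-nonNeg v z = *-nonNeg (fromℕ-nonNeg (I ρ v (σ v z) 0 z ℕ.+ 1)) (pos⇒⁻¹-nonNeg (σ∈𝒩 v z))

    -- The count of `u` rises only when `u` is chosen, and at that moment the new count equals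
    -- `θ v z * P v u`; afterwards `θ` only grows.
    I≤θP : ∀ v u z → fromℕ (I ρ v u 0 z) ≤ θ v z * P v u
    I≤θP v u zero    = *-nonNeg (θ-nonNeg v 0) (P-nonNeg v u)
    I≤θP v u (suc z) = ≤-trans step (*-monoʳ-≤ (P-nonNeg v u) (θ-mono v z))
      where
      step : fromℕ (I ρ v u 0 (suc z)) ≤ θ v z * P v u
      step with σ v z Fin.≟ u | fromℕ-I-suc v u z
      ... | yes ≡.refl | I-suc = ≤-reflexive (≈-trans I-suc (≈-sym
        (≈-trans (/-*-cancel (σ∈𝒩 v z)) (fromℕ-I+1 v u z))))
      ... | no _       | I-suc = ≤-respˡ-≈ (≈-sym (≈-trans I-suc (+-identityʳ _))) (I≤θP v u z)

    θP≤I+1 : ∀ v u z → 0# < P v u → θ v z * P v u ≤ fromℕ (I ρ v u 0 z) + 1#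
    θP≤I+1 v u z 0<P = ≤-respʳ-≈ (≈-trans (/-*-cancel 0<P) (fromℕ-I+1 v u z))
      (*-monoʳ-≤ (proj₁ 0<P) (billiard v z u 0<P))

    -- A fractional part of `θ v z * P v u`, up to ties; hence its values lie between 0 and 1.
    lag : Fin N → Fin N → ℕ → Carrier
    lag v u z = θ v z * P v u - fromℕ (I ρ v u 0 z)

    lag-nonNeg : ∀ v u z → 0# ≤ lag v u z
    lag-nonNeg v u z = 0≤y-x (I≤θP v u z)

    non-nbr⇒P≈0 : ∀ v u → ¬ 0# < P v u → P v u ≈ 0#
    non-nbr⇒P≈0 v u 0≮P with P v u ≟ 0#
    ... | yes P≈0 = P≈0
    ... | no  P≉0 = contradiction (pos (P-nonNeg v u) P≉0) 0≮P

    lag≤nbr : ∀ v u z → lag v u z ≤ nbr P v u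
    lag≤nbr v u z with nbr-cases P v u
    ... | inj₁ (0<P , nbr≡1) rewrite nbr≡1 = ≤-respʳ-≈ (solve 1 (λ i → i :+ con (+ 1) :- i := con (+ 1)) ≈-refl (fromℕ (I ρ v u 0 z)))
      (+-monoˡ-≤ (- fromℕ (I ρ v u 0 z)) (θP≤I+1 v u z 0<P))
    ... | inj₂ (0≮P , nbr≡0) rewrite nbr≡0 = ≤-via-gap (fromℕ (I ρ v u 0 z)) (fromℕ-nonNeg (I ρ v u 0 z)) (begin
      0#
        ≈⟨ zeroʳ _ ⟨
      θ v z * 0#
        ≈⟨ *-congˡ (non-nbr⇒P≈0 v u 0≮P) ⟨
      θ v z * P v u
        ≈⟨ solve 2 (λ t i → t := t :- i :+ i) ≈-refl (θ v z * P v u) (fromℕ (I ρ v u 0 z)) ⟩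
      lag v u z + fromℕ (I ρ v u 0 z)
        ∎)
      where open ≈-Reasoning

    module _ (v : Fin N) (z n : ℕ) where

      J e : Fin N → Carrier
      J u = fromℕ (I ρ v u z (z ℕ.+ n))
      e u = lag v u z - lag v u (z ℕ.+ n)

      -- How far the clock `θ v` advances during the `n` calls. It need not equal `n`; `sum-e`
      -- measures the difference.
      s : Carrier
      s = θ v (z ℕ.+ n) - θ v z

      e≈J-sP : ∀ u → e u ≈ J u - s * P v u
      e≈J-sP u = ≈-trans
        (+-congˡ (-‿cong (+-congˡ (-‿cong
          (≈-trans (≈-reflexive (≡.cong fromℕ (I-+ v u z n))) (fromℕ-+ (I ρ v u 0 z) _))))))
        (solve 5 (λ a b p i j → a :* p :- i :- (b :* p :- (i :+ j)) := j :- (b :- a) :* p) ≈-refl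
          (θ v z) (θ v (z ℕ.+ n)) (P v u) (fromℕ (I ρ v u 0 z)) (J u))

      -- Both lags lie between 0 and `nbr P v u`, so their difference costs no factor 2.
      ∣e∣≤nbr : ∀ u → ∣ e u ∣ᵣ ≤ nbr P v u
      ∣e∣≤nbr u = ⊔-lub
        (≤-trans (≤-via-gap _ (lag-nonNeg v u (z ℕ.+ n))
          (solve 2 (λ a b → a := a :- b :+ b) ≈-refl (lag v u z) (lag v u (z ℕ.+ n)))) (lag≤nbr v u z))
        (≤-trans (≤-via-gap _ (lag-nonNeg v u z)
          (solve 2 (λ a b → b := :- (a :- b) :+ a) ≈-refl (lag v u z) (lag v u (z ℕ.+ n))))
          (lag≤nbr v u (z ℕ.+ n)))

      sum-e : sum e ≈ fromℕ n - s
      sum-e = begin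
        sum e
          ≈⟨ sum-cong-≋ e≈J-sP ⟩
        ∑[ u < N ] (J u - s * P v u)
          ≈⟨ sum-sub J (λ u → s * P v u) ⟩
        sum J - ∑[ u < N ] (s * P v u)
          ≈⟨ +-cong (sum-I v z n) (-‿cong (≈-trans (≈-sym (*-distribˡ-sum s (P v)))
               (≈-trans (*-congˡ (P-rowSum v)) (*-identityʳ s)))) ⟩
        fromℕ n - s
          ∎
        where open ≈-Reasoning

      -- As J sums to n and P v to 1, the increment s of θ cancels from
      -- e u - P v u * sum e, which leaves J u - n * P v u.
      coeff : Fin N → Fin N → Carrier
      coeff u x = 𝟙 (does (u Fin.≟ x)) - P v u

      J-nP≈sum : ∀ u → J u - fromℕ n * P v u ≈ ∑[ x < N ] (coeff u x * e x)
      J-nP≈sum u = begin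
        J u - fromℕ n * P v u
          ≈⟨ solve 4 (λ j n s p → j :- n :* p := j :- s :* p :- p :* (n :- s)) ≈-refl
               (J u) (fromℕ n) s (P v u) ⟩
        J u - s * P v u - P v u * (fromℕ n - s)
          ≈⟨ +-cong (≈-sym (e≈J-sP u)) (-‿cong (*-congˡ (≈-sym sum-e))) ⟩
        e u - P v u * sum e
          ≈⟨ +-cong (≈-sym (sum-𝟙-≟ u e)) (-‿cong (*-distribˡ-sum (P v u) e)) ⟩
        ∑[ x < N ] (𝟙 (does (u Fin.≟ x)) * e x) - ∑[ x < N ] (P v u * e x)
          ≈⟨ sum-sub (λ x → 𝟙 (does (u Fin.≟ x)) * e x) (λ x → P v u * e x) ⟨
        ∑[ x < N ] (𝟙 (does (u Fin.≟ x)) * e x - P v u * e x)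
          ≈⟨ sum-cong-≋ (λ x → solve 3 (λ i p e → i :* e :- p :* e := (i :- p) :* e) ≈-refl
               (𝟙 (does (u Fin.≟ x))) (P v u) (e x)) ⟩
        ∑[ x < N ] (coeff u x * e x)
          ∎
        where open ≈-Reasoning

      -- The bound is `1# - P v u` at `x = u` and `P v u` elsewhere, written as one expression so
      -- that it can be summed.
      ∣coeff∣≤ : ∀ u x → ∣ coeff u x ∣ᵣ ≤
        𝟙 (does (u Fin.≟ x)) * (1# - (P v u + P v u)) + P v u
      ∣coeff∣≤ u x with does (u Fin.≟ x)
      ... | true  = ≤-reflexive (≈-trans (∣x∣≈x (0≤y-x (P≤1 v u)))
        (solve 1 (λ p → con (+ 1) :- p := con (+ 1) :* (con (+ 1) :- (p :+ p)) :+ p) ≈-refl (P v u)))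
      ... | false = ≤-reflexive (≈-trans (∣∣-cong (+-identityˡ _)) (≈-trans (∣-x∣≈∣x∣ _)
        (≈-trans (∣x∣≈x (P-nonNeg v u)) (≈-sym (≈-trans (+-congʳ (zeroˡ _)) (+-identityˡ _))))))

      -- For a neighbour `u` this is the classical billiard bound 1 + (δ - 2) P: among the δ
      -- neighbours `x`, one contributes 1 - P and the others P each.
      ∣J-nP∣≤ : ∀ u → ∣ J u - fromℕ n * P v u ∣ᵣ ≤
        nbr P v u * (1# - (P v u + P v u)) + P v u * fromℕ (δ P v)
      ∣J-nP∣≤ u = begin
        ∣ J u - fromℕ n * P v u ∣ᵣ
          ≈⟨ ∣∣-cong (J-nP≈sum u) ⟩
        ∣ ∑[ x < N ] (coeff u x * e x) ∣ᵣ
          ≤⟨ ∣sum∣≤sum∣∣ (λ x → coeff u x * e x) ⟩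
        ∑[ x < N ] ∣ coeff u x * e x ∣ᵣ
          ≤⟨ sum-mono-≤ (λ x → ≤-respˡ-≈ (≈-sym (∣x*y∣≈∣x∣*∣y∣ (coeff u x) (e x)))
               (≤-trans (*-monoˡ-≤ (∣∣-nonNeg _) (∣e∣≤nbr x))
                        (*-monoʳ-≤ (𝟙-nonNeg (does (0# <? P v x))) (∣coeff∣≤ u x)))) ⟩
        ∑[ x < N ] ((𝟙 (does (u Fin.≟ x)) * b + P v u) * nbr P v x)
          ≈⟨ sum-cong-≋ (λ x → solve 4 (λ i b p m → (i :* b :+ p) :* m := i :* (m :* b) :+ p :* m)
               ≈-refl (𝟙 (does (u Fin.≟ x))) b (P v u) (nbr P v x)) ⟩
        ∑[ x < N ] (𝟙 (does (u Fin.≟ x)) * (nbr P v x * b) + P v u * nbr P v x)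
          ≈⟨ ∑-distrib-+ (λ x → 𝟙 (does (u Fin.≟ x)) * (nbr P v x * b)) (λ x → P v u * nbr P v x) ⟩
        ∑[ x < N ] (𝟙 (does (u Fin.≟ x)) * (nbr P v x * b)) + ∑[ x < N ] (P v u * nbr P v x)
          ≈⟨ +-cong (sum-𝟙-≟ u (λ x → nbr P v x * b))
               (≈-trans (≈-sym (*-distribˡ-sum (P v u) (nbr P v))) (*-congˡ (≈-sym (fromℕ-δ P v)))) ⟩
        nbr P v u * b + P v u * fromℕ (δ P v)
          ∎
        where
        open ≤-Reasoning
        b = 1# - (P v u + P v u)

    P≤nbr : ∀ v u → P v u ≤ nbr P v u
    P≤nbr v u with nbr-cases P v u
    ... | inj₁ (_ , nbr≡1)   rewrite nbr≡1 = P≤1 v u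
    ... | inj₂ (0≮P , nbr≡0) rewrite nbr≡0 = ≤-reflexive (non-nbr⇒P≈0 v u 0≮P)

    -- The terms `nbr P v x - P v x` are nonnegative and sum to δ - 1; the left side is the term at
    -- `x = u`.
    1-P≤δ-1 : ∀ v u → 0# < P v u → 1# - P v u ≤ fromℕ (δ P v) - 1#
    1-P≤δ-1 v u 0<P with nbr-cases P v u
    ... | inj₂ (0≮P , _)   = contradiction 0<P 0≮P
    ... | inj₁ (_ , nbr≡1) = ≤-respˡ-≈ (+-congʳ (≈-reflexive nbr≡1)) (≤-respʳ-≈
      (≈-trans (sum-sub (nbr P v) (P v)) (+-cong (≈-sym (fromℕ-δ P v)) (-‿cong (P-rowSum v))))
      (term≤sum (λ x → 0≤y-x (P≤nbr v x)) u))

    -- When δ = 1 the only neighbour has P = 1; otherwise δ - 2 ≥ 0.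
    1+[δ-2]P≤δ-1 : ∀ d p → p ≤ 1# → 1# - p ≤ fromℕ d - 1# →
      1# - (p + p) + p * fromℕ d ≤ fromℕ d - 1#
    1+[δ-2]P≤δ-1 zero p p≤1 1-p≤-1 = contradiction
      (≤-respˡ-≈ (+-identityˡ 1#) (≤-respʳ-≈
        (solve 0 (con (+ 0) :- con (+ 1) :+ con (+ 1) := con (+ 0)) ≈-refl)
        (+-monoˡ-≤ 1# (≤-trans (0≤y-x p≤1) 1-p≤-1))))
      1≰0
    1+[δ-2]P≤δ-1 (suc zero) p p≤1 1-p≤0 = ≤-respˡ-≈
      (solve 1 (λ p → con (+ 1) :- p := con (+ 1) :- (p :+ p) :+ p :* (con (+ 1) :+ con (+ 0))) ≈-refl p)
      1-p≤0
    -- With d = k + 2 the difference of the two sides factors as k (1 - p).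
    1+[δ-2]P≤δ-1 (suc (suc k)) p p≤1 _ = ≤-via-gap (fromℕ k * (1# - p))
      (*-nonNeg (fromℕ-nonNeg k) (0≤y-x p≤1))
      (solve 2 (λ k p → con (+ 1) :+ (con (+ 1) :+ k) :- con (+ 1) :=
        con (+ 1) :- (p :+ p) :+ p :* (con (+ 1) :+ (con (+ 1) :+ k)) :+ k :* (con (+ 1) :- p))
        ≈-refl (fromℕ k) p)

    -- Gives up the dependence on the size of `P v u` but keeps the factor `nbr P v u`, so that
    -- summing over `v` will count neighbours.
    discrepancy : ∀ v u z n → ∣ fromℕ (I ρ v u z (z ℕ.+ n)) - fromℕ n * P v u ∣ᵣ ≤
      nbr P v u * (fromℕ (δ P v) - 1#)
    discrepancy v u z n = bound (nbr-cases P v u)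
      where
      bound : (0# < P v u × nbr P v u ≡ 1#) ⊎ (¬ 0# < P v u × nbr P v u ≡ 0#) → _
      bound (inj₁ (0<P , nbr≡1)) = begin
        ∣ J v z n u - fromℕ n * P v u ∣ᵣ
          ≤⟨ ∣J-nP∣≤ v z n u ⟩
        nbr P v u * (1# - (P v u + P v u)) + P v u * fromℕ (δ P v)
          ≈⟨ +-congʳ (≈-trans (*-congʳ (≈-reflexive nbr≡1)) (*-identityˡ _)) ⟩
        1# - (P v u + P v u) + P v u * fromℕ (δ P v)
          ≤⟨ 1+[δ-2]P≤δ-1 (δ P v) (P v u) (P≤1 v u) (1-P≤δ-1 v u 0<P) ⟩
        fromℕ (δ P v) - 1#
          ≈⟨ ≈-trans (*-congʳ (≈-reflexive nbr≡1)) (*-identityˡ _) ⟨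
        nbr P v u * (fromℕ (δ P v) - 1#)
          ∎
        where open ≤-Reasoning
      bound (inj₂ (0≮P , nbr≡0)) = begin
        ∣ J v z n u - fromℕ n * P v u ∣ᵣ
          ≤⟨ ∣J-nP∣≤ v z n u ⟩
        nbr P v u * (1# - (P v u + P v u)) + P v u * fromℕ (δ P v)
          ≈⟨ +-cong (≈-trans (*-congʳ (≈-reflexive nbr≡0)) (zeroˡ _))
               (≈-trans (*-congʳ (non-nbr⇒P≈0 v u 0≮P)) (zeroˡ _)) ⟩
        0# + 0#
          ≈⟨ +-identityʳ 0# ⟩
        0#
          ≈⟨ ≈-trans (*-congʳ (≈-reflexive nbr≡0)) (zeroˡ _) ⟨
        nbr P v u * (fromℕ (δ P v) - 1#)
          ∎
        where open ≤-Reasoning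

  -- Comparison of the router with the chain

  module Discrepancy {P : Matrix N} {π : Fin N → Carrier}
    (stochastic : IsStochastic P) (irreducible : IsIrreducible P)
    (stationary : IsStationary P π) (reversible : IsReversible P π)
    (ρ : Router P) (billiard : IsBilliard ρ) (χ₀ : Fin N → ℕ) where

    open Norm ℛ
    open Chain.Reversible ℛ stochastic stationary reversible
    open Irreducible irreducible
    open Counting ρ
    open Router ρ using (σ; σ∈𝒩)
    open Billiard stochastic ρ billiard using (discrepancy; 1-P≤δ-1)

    fromℕ-sumℕ : ∀ {n} (f : Fin n → ℕ) → fromℕ (sumℕ f) ≈ ∑[ i < n ] fromℕ (f i)
    fromℕ-sumℕ {zero}  f = ≈-refl
    fromℕ-sumℕ {suc n} f = ≈-trans (fromℕ-+ (f zero) _) (+-congˡ (fromℕ-sumℕ (f ∘ suc)))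

    X : ℕ → Fin N → Carrier
    X t v = fromℕ (χ ρ χ₀ t v)

    E : ℕ → Fin N → Fin N → Carrier
    E t v u = fromℕ (Z ρ χ₀ t v u) - X t v * P v u

    Δ-1 : Carrier
    Δ-1 = fromℕ (Δ P) - 1#

    E-sum : ∀ t v → sum (E t v) ≈ 0#
    E-sum t v = begin
      sum (E t v)
        ≈⟨ sum-sub (λ u → fromℕ (Z ρ χ₀ t v u)) (λ u → X t v * P v u) ⟩
      ∑[ u < N ] fromℕ (Z ρ χ₀ t v u) - ∑[ u < N ] (X t v * P v u)
        ≈⟨ +-cong (sum-I v (served ρ χ₀ t v) (χ ρ χ₀ t v))
             (-‿cong (≈-trans (≈-sym (*-distribˡ-sum (X t v) (P v)))
               (≈-trans (*-congˡ (P-rowSum v)) (*-identityʳ _)))) ⟩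
      X t v - X t v
        ≈⟨ -‿inverseʳ _ ⟩
      0#
        ∎
      where open ≈-Reasoning

    ∣E∣≤ : ∀ t v u → ∣ E t v u ∣ᵣ ≤ nbr P v u * Δ-1
    ∣E∣≤ t v u = ≤-trans (discrepancy v u (served ρ χ₀ t v) (χ ρ χ₀ t v))
      (*-monoˡ-≤ (𝟙-nonNeg (does (0# <? P v u))) (+-monoˡ-≤ (- 1#) (δ≤Δ P v)))

    nbr≤nbr : ∀ v u → nbr P v u ≤ nbr P u v
    nbr≤nbr v u with nbr-cases P v u | nbr-cases P u v
    ... | inj₁ (_ , vu≡1)   | inj₁ (_ , uv≡1)   = ≤-reflexive (≈-reflexive (≡.trans vu≡1 (≡.sym uv≡1)))
    ... | inj₁ (0<Pvu , _)  | inj₂ (0≮Puv , _)  = contradiction (P-pos-sym 0<Pvu) 0≮Puv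
    ... | inj₂ (_ , vu≡0)   | _                 =
      ≤-respˡ-≈ (≈-reflexive (≡.sym vu≡0)) (𝟙-nonNeg (does (0# <? P u v)))

    sum-nbrˡ≤Δ : ∀ u → ∑[ v < N ] nbr P v u ≤ fromℕ (Δ P)
    sum-nbrˡ≤Δ u = begin
      ∑[ v < N ] nbr P v u  ≤⟨ sum-mono-≤ (λ v → nbr≤nbr v u) ⟩
      sum (nbr P u)         ≈⟨ fromℕ-δ P u ⟨
      fromℕ (δ P u)         ≤⟨ δ≤Δ P u ⟩
      fromℕ (Δ P)           ∎
      where open ≤-Reasoning

    -- The router at the given state supplies a neighbour `σ w 0`, which forces the degree there to
    -- be at least one.
    Δ-1-nonNeg : Fin N → 0# ≤ Δ-1
    Δ-1-nonNeg w = ≤-trans (0≤y-x (P≤1 w u))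
      (≤-trans (1-P≤δ-1 w u (σ∈𝒩 w 0)) (+-monoˡ-≤ (- 1#) (δ≤Δ P w)))
      where u = σ w 0

    module _ (w : Fin N) where

      C : Carrier
      C = π w / πmin π * (fromℕ (Δ P) * Δ-1)

      -- A hybrid process: `t` steps of the router, then `s` steps of the chain, observed at `w`. It
      -- is `X T w` at `(T , 0)` and `μ P χ₀ T w` at `(0 , T)`.
      transported : ℕ → ℕ → Carrier
      transported t s = ∑[ u < N ] (X t u * (P ^ s) u w)

      transported-step : ∀ t s → transported (suc t) s - transported t (suc s) ≈
        ∑[ u < N ] ∑[ v < N ] (E t v u * ((P ^ s) u w - π w))
      transported-step t s = begin
        transported (suc t) s - transported t (suc s)
          -- Splitting the first step off `P ^ suc s` makes both processes weight the arrivals at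
          -- `u` by the same `p u`.
          ≈⟨ +-cong
               (sum-cong-≋ (λ u → *-congʳ (fromℕ-sumℕ (λ v → Z ρ χ₀ t v u))))
               (-‿cong (≈-trans (sum-cong-≋ (λ v → *-congˡ (^-sucˡ s v w)))
                 (≈-sym (∑-assoc (X t) P (λ u → p u))))) ⟩
        ∑[ u < N ] ((∑[ v < N ] fromℕ (Z ρ χ₀ t v u)) * p u) -
          ∑[ u < N ] ((∑[ v < N ] (X t v * P v u)) * p u)
          ≈⟨ sum-sub (λ u → (∑[ v < N ] fromℕ (Z ρ χ₀ t v u)) * p u)
               (λ u → (∑[ v < N ] (X t v * P v u)) * p u) ⟨
        ∑[ u < N ] ((∑[ v < N ] fromℕ (Z ρ χ₀ t v u)) * p u - (∑[ v < N ] (X t v * P v u)) * p u)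
          ≈⟨ sum-cong-≋ (λ u → ≈-trans
               (solve 3 (λ a b p → a :* p :- b :* p := (a :- b) :* p) ≈-refl _ _ (p u))
               (*-congʳ (≈-sym (sum-sub (λ v → fromℕ (Z ρ χ₀ t v u)) (λ v → X t v * P v u))))) ⟩
        ∑[ u < N ] ((∑[ v < N ] E t v u) * p u)
          ≈⟨ solve 2 (λ a b → a := a :- con (+ 0) :* b) ≈-refl _ (π w) ⟩
        ∑[ u < N ] ((∑[ v < N ] E t v u) * p u) - 0# * π w
          ≈⟨ +-congˡ (-‿cong (*-congʳ (≈-trans (≈-sym (sum-zero (E-sum t))) (∑-comm (E t))))) ⟩
        ∑[ u < N ] ((∑[ v < N ] E t v u) * p u) - (∑[ u < N ] ∑[ v < N ] E t v u) * π w
          ≈⟨ +-congˡ (-‿cong (*-distribʳ-sum (π w) (λ u → ∑[ v < N ] E t v u))) ⟩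
        ∑[ u < N ] ((∑[ v < N ] E t v u) * p u) - ∑[ u < N ] ((∑[ v < N ] E t v u) * π w)
          ≈⟨ sum-sub (λ u → (∑[ v < N ] E t v u) * p u) (λ u → (∑[ v < N ] E t v u) * π w) ⟨
        ∑[ u < N ] ((∑[ v < N ] E t v u) * p u - (∑[ v < N ] E t v u) * π w)
          ≈⟨ sum-cong-≋ (λ u → ≈-trans
               (solve 3 (λ a p q → a :* p :- a :* q := a :* (p :- q)) ≈-refl _ (p u) (π w))
               (*-distribʳ-sum (p u - π w) (λ v → E t v u))) ⟩
        ∑[ u < N ] ∑[ v < N ] (E t v u * (p u - π w))
          ∎
        where
        open ≈-Reasoning
        p : Fin N → Carrier
        p u = (P ^ s) u w

      -- The sum over `v` is taken first: at fixed `u` it counts the states with `u` as a neighbour.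
      -- Then the column deviation `q` is exchanged for a row deviation, whose sum over `u` is a
      -- norm.
      ∣transported-step∣≤ : ∀ t s →
        ∣ transported (suc t) s - transported t (suc s) ∣ᵣ ≤ C * ‖ dev s w ‖₁
      ∣transported-step∣≤ t s = begin
        ∣ transported (suc t) s - transported t (suc s) ∣ᵣ
          ≈⟨ ∣∣-cong (transported-step t s) ⟩
        ∣ ∑[ u < N ] ∑[ v < N ] (E t v u * q u) ∣ᵣ
          ≤⟨ ∣sum∣≤sum∣∣ (λ u → ∑[ v < N ] (E t v u * q u)) ⟩
        ∑[ u < N ] ∣ ∑[ v < N ] (E t v u * q u) ∣ᵣ
          ≤⟨ sum-mono-≤ (λ u → ∣sum∣≤sum∣∣ (λ v → E t v u * q u)) ⟩
        ∑[ u < N ] ∑[ v < N ] ∣ E t v u * q u ∣ᵣ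
          ≤⟨ sum-mono-≤ (λ u → sum-mono-≤ (λ v → ≤-respˡ-≈ (≈-sym (∣x*y∣≈∣x∣*∣y∣ (E t v u) (q u)))
               (*-monoʳ-≤ (∣∣-nonNeg (q u)) (∣E∣≤ t v u)))) ⟩
        ∑[ u < N ] ∑[ v < N ] (nbr P v u * Δ-1 * ∣ q u ∣ᵣ)
          ≈⟨ sum-cong-≋ (λ u → sum-cong-≋ (λ v → *-assoc (nbr P v u) Δ-1 ∣ q u ∣ᵣ)) ⟩
        ∑[ u < N ] ∑[ v < N ] (nbr P v u * (Δ-1 * ∣ q u ∣ᵣ))
          ≈⟨ sum-cong-≋ (λ u → *-distribʳ-sum (Δ-1 * ∣ q u ∣ᵣ) (λ v → nbr P v u)) ⟨
        ∑[ u < N ] (∑[ v < N ] nbr P v u * (Δ-1 * ∣ q u ∣ᵣ))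
          ≤⟨ sum-mono-≤ (λ u → *-monoʳ-≤ (*-nonNeg (Δ-1-nonNeg w) (∣∣-nonNeg (q u))) (sum-nbrˡ≤Δ u)) ⟩
        ∑[ u < N ] (fromℕ (Δ P) * (Δ-1 * ∣ q u ∣ᵣ))
          ≤⟨ sum-mono-≤ (λ u → *-monoˡ-≤ (fromℕ-nonNeg (Δ P)) (*-monoˡ-≤ (Δ-1-nonNeg w) (∣^-π∣≤ s u w))) ⟩
        ∑[ u < N ] (fromℕ (Δ P) * (Δ-1 * (π w / πmin π * ∣ dev s w u ∣ᵣ)))
          ≈⟨ sum-cong-≋ (λ u → solve 4 (λ a b d e → a :* (b :* (d :* e)) := d :* (a :* b) :* e) ≈-refl
               (fromℕ (Δ P)) Δ-1 (π w / πmin π) ∣ dev s w u ∣ᵣ) ⟩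
        ∑[ u < N ] (C * ∣ dev s w u ∣ᵣ)
          ≈⟨ *-distribˡ-sum C (λ u → ∣ dev s w u ∣ᵣ) ⟨
        C * ‖ dev s w ‖₁
          ∎
        where
        open ≤-Reasoning
        q : Fin N → Carrier
        q u = (P ^ s) u w - π w

      -- Telescopes along the hybrids with `T + s` fixed; a general `s` is needed because each step
      -- of the induction raises it.
      ∣transported-μ∣≤ : ∀ T s → ∣ transported T s - μ P χ₀ (T ℕ.+ s) w ∣ᵣ ≤
        C * partialSum (λ s → ‖ dev s w ‖₁) s T
      -- `transported 0 s` is `μ P χ₀ s w` by definition.
      ∣transported-μ∣≤ zero    s = ≤-reflexive (≈-trans (∣∣-cong (-‿inverseʳ _))
        (≈-trans (∣x∣≈x ≤-refl) (≈-sym (zeroʳ C))))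
      ∣transported-μ∣≤ (suc T) s = begin
        ∣ transported (suc T) s - μ P χ₀ (suc T ℕ.+ s) w ∣ᵣ
          ≡⟨ ≡.cong (λ k → ∣ transported (suc T) s - μ P χ₀ k w ∣ᵣ) (ℕ.+-suc T s) ⟨
        ∣ transported (suc T) s - m ∣ᵣ
          ≈⟨ ∣∣-cong (solve 3 (λ a b m → a :- m := a :- b :+ (b :- m)) ≈-refl
               (transported (suc T) s) (transported T (suc s)) m) ⟩
        ∣ transported (suc T) s - transported T (suc s) + (transported T (suc s) - m) ∣ᵣ
          ≤⟨ ∣x+y∣≤∣x∣+∣y∣ _ _ ⟩
        ∣ transported (suc T) s - transported T (suc s) ∣ᵣ + ∣ transported T (suc s) - m ∣ᵣ
          ≤⟨ +-mono-≤ (∣transported-step∣≤ T s) (∣transported-μ∣≤ T (suc s)) ⟩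
        C * ‖ dev s w ‖₁ + C * partialSum (λ s → ‖ dev s w ‖₁) (suc s) T
          ≈⟨ distribˡ C _ _ ⟨
        C * partialSum (λ s → ‖ dev s w ‖₁) s (suc T)
          ∎
        where
        open ≤-Reasoning
        m = μ P χ₀ (T ℕ.+ suc s) w

      ∣χ-μ∣≤ : ∀ {t*} → IsMixingRate P π t* → ∀ T →
        ∣ X T w - μ P χ₀ T w ∣ᵣ ≤
          fromℕ 3 * π w / πmin π * fromℕ t* * (fromℕ (Δ P) * Δ-1)
      ∣χ-μ∣≤ {t*} mixing T = begin
        ∣ X T w - μ P χ₀ T w ∣ᵣ
          ≈⟨ ∣∣-cong (+-cong (≈-sym (sum-𝟙-≟ʳ (X T) w))
               (-‿cong (≈-reflexive (≡.cong (λ k → μ P χ₀ k w) (≡.sym (ℕ.+-identityʳ T)))))) ⟩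
        ∣ transported T 0 - μ P χ₀ (T ℕ.+ 0) w ∣ᵣ
          ≤⟨ ∣transported-μ∣≤ T 0 ⟩
        C * partialSum (λ s → ‖ dev s w ‖₁) 0 T
          ≤⟨ *-monoˡ-≤ C-nonNeg (partialSum-‖dev‖₁ mixing w T) ⟩
        C * (fromℕ 3 * fromℕ t*)
          ≈⟨ solve 5 (λ p i d m t → p :* i :* d :* (m :* t) := m :* p :* i :* t :* d) ≈-refl
               (π w) (πmin π ⁻¹) (fromℕ (Δ P) * Δ-1) (fromℕ 3) (fromℕ t*) ⟩
        fromℕ 3 * π w / πmin π * fromℕ t* * (fromℕ (Δ P) * Δ-1)
          ∎
        where
        open ≤-Reasoning
        C-nonNeg : 0# ≤ C
        C-nonNeg = *-nonNeg (*-nonNeg (π-nonNeg w) (pos⇒⁻¹-nonNeg πmin-pos))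
          (*-nonNeg (fromℕ-nonNeg (Δ P)) (Δ-1-nonNeg w))

theorem5p3 : ∀ {c ℓ₁ ℓ₂} (ℛ : Reals c ℓ₁ ℓ₂) →
    let open Reals ℛ
        open Routing ℛ in
    (N : ℕ) (P : Matrix N) (π : Fin N → Carrier) (t* : ℕ) →
    IsStochastic P → IsErgodic P →
    IsStationary P π → IsReversible P π → IsMixingRate P π t* →
    (ρ : Router P) → IsBilliard ρ →
    (χ₀ : Fin N → ℕ) (w : Fin N) (T : ℕ) →
    ∣ fromℕ (χ ρ χ₀ T w) - μ P χ₀ T w ∣ᵣ
      ≤ fromℕ 3 * π w / πmin π * fromℕ t* * (fromℕ (Δ P) * (fromℕ (Δ P) - 1#))
theorem5p3 ℛ N P π t* stochastic (irreducible , _) stationary reversible mixing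
  ρ billiard χ₀ w T = ∣χ-μ∣≤ w mixing T
  where
  open Routers.Discrepancy ℛ stochastic irreducible stationary reversible ρ billiard χ₀
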